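{- Let $R_d$ denote the optimal expected rendezvous time over admissible oblivious self-distance strategies at initial separation $2d$. Then $R_d=\Omega(d^2)$ for every $d\ge 1$; that is, there is a universal constant $c>0$ such that $R_d\ge c\,d^2$ for every integer $d\ge1$ (equivalently, $\mathbb E[\mathcal T_d(a)]\ge c\,d^2$ for every integer $d\geq 1$ and every admissible strategy $a$).
   Context: An admissible strategy is a sequence $a=(a_i)_{i\ge 0}$ with $a_i\in[0,1]$ and $a_0=\tfrac12$; $\mathcal A$ is the set of admissible strategies. Extend $a$ to a signed sequence $(b_i)_{i\in\mathbb Z}$ by $b_i=a_i$ for $i\ge0$ and $b_i=1-a_{ -i}$ for $i<0$. Two independent Markov chains $(X_t)_{t\ge0},(Y_t)_{t\ge 0}$ on $\mathbb Z$ start at $X_0=Y_0=0$; each moves from $k$ to $k+1$ with probability $b_k$ and to $k-1$ with probability $1-b_k$. (These are the displacements of two agents from their starting points $-d$ and $d$.) For an integer $d\ge1$ the rendezvous time is $\mathcal T_d(a)=\inf\{t\ge0: X_t=Y_t+2d\}$ (with value $\infty$ if there is no such $t$), and $$R_d=\inf_{a\in\mathcal A}\mathbb E[\mathcal T_d(a)].$$ -}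

module Defs where

open import Data.Bool.Base using (if_then_else_)
open import Data.Integer.Base as ℤ using (ℤ; +_; -[1+_])
import Data.Integer.Properties as ℤ
open import Data.Maybe.Base as Maybe using (Maybe; just; nothing; fromMaybe)
open import Data.Nat.Base as ℕ using (ℕ; zero; suc)
import Data.Nat.Properties as ℕ
open import Data.Product.Base using (∃-syntax; _×_; _,_)
open import Data.Rational.Base as ℚ using (ℚ; 0ℚ; 1ℚ; ½)
import Data.Rational.Properties as ℚ
open import Data.Rational.Solver using (module +-*-Solver)
open import Data.Vec.Base using (Vec; []; _∷_)
open import Relation.Binary.PropositionalEquality
  using (_≡_; refl; sym; trans; cong; subst; subst₂)
open import Relation.Nullary.Decidable using (does)

open +-*-Solver using (solve; _:=_; _:+_; _:*_; _:-_; :-_)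

------------------------------------------------------------------------
-- Real numbers as Cauchy sequences of rationals, with _≃ᵣ_ as equality.

IsCauchy : (ℕ → ℚ) → Set
IsCauchy f = ∀ ε → 0ℚ ℚ.< ε →
  ∃[ N ] (∀ m n → N ℕ.≤ m → N ℕ.≤ n → ℚ.∣ f m ℚ.- f n ∣ ℚ.< ε)

record ℝ : Set where
  constructor mkℝ
  field
    seq    : ℕ → ℚ
    cauchy : IsCauchy seq
open ℝ public

infix 4 _<ᵣ_ _≤ᵣ_ _≃ᵣ_

_<ᵣ_ : ℝ → ℝ → Set
x <ᵣ y = ∃[ ε ] (0ℚ ℚ.< ε × ∃[ N ] (∀ n → N ℕ.≤ n → seq x n ℚ.+ ε ℚ.≤ seq y n))

_≤ᵣ_ : ℝ → ℝ → Set
x ≤ᵣ y = ∀ ε → 0ℚ ℚ.< ε → ∃[ N ] (∀ n → N ℕ.≤ n → seq x n ℚ.≤ seq y n ℚ.+ ε)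

_≃ᵣ_ : ℝ → ℝ → Set
x ≃ᵣ y = ∀ ε → 0ℚ ℚ.< ε →
  ∃[ N ] (∀ n → N ℕ.≤ n → ℚ.∣ seq x n ℚ.- seq y n ∣ ℚ.< ε)

private
  -- Opaque, since normalising proofs about rationals is very slow.
  opaque
    0<1 : 0ℚ ℚ.< 1ℚ
    0<1 = ℚ.positive⁻¹ 1ℚ

    half>0 : ∀ {ε} → 0ℚ ℚ.< ε → 0ℚ ℚ.< ½ ℚ.* ε
    half>0 {ε} 0<ε = subst (ℚ._< ½ ℚ.* ε) (ℚ.*-zeroʳ ½) (ℚ.*-monoʳ-<-pos ½ 0<ε)

    half+half : ∀ ε → ½ ℚ.* ε ℚ.+ ½ ℚ.* ε ≡ ε
    half+half ε = trans (sym (ℚ.*-distribʳ-+ ε ½ ½)) (ℚ.*-identityˡ ε)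

    sub-add : ∀ x y → (x ℚ.- y) ℚ.+ y ≡ x
    sub-add = solve 2 (λ x y → (x :- y) :+ y := x) refl

    neg-sub : ∀ x y → y ℚ.- x ≡ (ℚ.- x) ℚ.- (ℚ.- y)
    neg-sub = solve 2 (λ x y → y :- x := (:- x) :- (:- y)) refl

    add-sub : ∀ w x y z → (w ℚ.- x) ℚ.+ (y ℚ.- z) ≡ (w ℚ.+ y) ℚ.- (x ℚ.+ z)
    add-sub = solve 4 (λ w x y z → (w :- x) :+ (y :- z) := (w :+ y) :- (x :+ z)) refl

    mul-sub : ∀ w x y z →
              w ℚ.* (y ℚ.- z) ℚ.+ z ℚ.* (w ℚ.- x) ≡ w ℚ.* y ℚ.- x ℚ.* z
    mul-sub = solve 4 (λ w x y z → w :* (y :- z) :+ z :* (w :- x) := w :* y :- x :* z) refl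

  ⊔≤⇒≤ˡ : ∀ {k} m n → m ℕ.⊔ n ℕ.≤ k → m ℕ.≤ k
  ⊔≤⇒≤ˡ m n = ℕ.≤-trans (ℕ.m≤m⊔n m n)

  ⊔≤⇒≤ʳ : ∀ {k} m n → m ℕ.⊔ n ℕ.≤ k → n ℕ.≤ k
  ⊔≤⇒≤ʳ m n = ℕ.≤-trans (ℕ.m≤n⊔m m n)

  Bound : (ℕ → ℚ) → Set
  Bound f = ∃[ B ] (0ℚ ℚ.< B × ∃[ N ] (∀ n → N ℕ.≤ n → ℚ.∣ f n ∣ ℚ.< B))

  opaque
    bound : ∀ {f} → IsCauchy f → Bound f
    bound {f} cf with cf 1ℚ 0<1
    ... | N , close =
      1ℚ ℚ.+ ℚ.∣ f N ∣
      , ℚ.+-mono-<-≤ 0<1 (ℚ.0≤∣p∣ (f N))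
      , N
      , λ n N≤n → ℚ.≤-<-trans
          (subst (λ z → ℚ.∣ z ∣ ℚ.≤ ℚ.∣ f n ℚ.- f N ∣ ℚ.+ ℚ.∣ f N ∣)
            (sub-add (f n) (f N))
            (ℚ.∣p+q∣≤∣p∣+∣q∣ (f n ℚ.- f N) (f N)))
          (ℚ.+-mono-<-≤ (close n N N≤n ℕ.≤-refl) (ℚ.≤-refl {ℚ.∣ f N ∣}))

    quotient : ∀ C {ε} → 0ℚ ℚ.< C → 0ℚ ℚ.< ε → ∃[ δ ] (0ℚ ℚ.< δ × C ℚ.* δ ≡ ε)
    quotient C {ε} 0<C 0<ε = C⁻¹ ℚ.* ε , 0<δ , Cδ≡ε
      where
      instance
        C>0 : ℚ.Positive C
        C>0 = ℚ.positive 0<C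

        C≢0 : ℚ.NonZero C
        C≢0 = ℚ.pos⇒nonZero C

      C⁻¹ : ℚ
      C⁻¹ = ℚ.1/ C

      0<δ : 0ℚ ℚ.< C⁻¹ ℚ.* ε
      0<δ = subst (ℚ._< C⁻¹ ℚ.* ε) (ℚ.*-zeroʳ C⁻¹)
        (ℚ.*-monoʳ-<-pos C⁻¹ {{ℚ.1/pos⇒pos C}} 0<ε)

      Cδ≡ε : C ℚ.* (C⁻¹ ℚ.* ε) ≡ ε
      Cδ≡ε = trans (sym (ℚ.*-assoc C C⁻¹ ε))
        (trans (cong (ℚ._* ε) (ℚ.*-inverseʳ C)) (ℚ.*-identityˡ ε))

    mul< : ∀ {x y B δ} → 0ℚ ℚ.< δ → ℚ.∣ x ∣ ℚ.< B → ℚ.∣ y ∣ ℚ.< δ →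
           ℚ.∣ x ℚ.* y ∣ ℚ.< B ℚ.* δ
    mul< {x} {y} {B} {δ} 0<δ x<B y<δ = subst (ℚ._< B ℚ.* δ) (sym (ℚ.∣p*q∣≡∣p∣*∣q∣ x y))
      (ℚ.≤-<-trans
        (ℚ.*-monoˡ-≤-nonNeg ℚ.∣ x ∣ {{ℚ.∣-∣-nonNeg x}} (ℚ.<⇒≤ y<δ))
        (ℚ.*-monoˡ-<-pos δ {{ℚ.positive 0<δ}} x<B))

  opaque
    mul-close : ∀ {A B δ} w x y z → 0ℚ ℚ.< δ → ℚ.∣ w ∣ ℚ.< A → ℚ.∣ z ∣ ℚ.< B →
                ℚ.∣ w ℚ.- x ∣ ℚ.< δ → ℚ.∣ y ℚ.- z ∣ ℚ.< δ →
                ℚ.∣ w ℚ.* y ℚ.- x ℚ.* z ∣ ℚ.< (A ℚ.+ B) ℚ.* δ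
    mul-close {A} {B} {δ} w x y z 0<δ w<A z<B wx yz =
      subst₂ (λ u v → ℚ.∣ u ∣ ℚ.< v) (mul-sub w x y z) (sym (ℚ.*-distribʳ-+ δ A B))
        (ℚ.≤-<-trans (ℚ.∣p+q∣≤∣p∣+∣q∣ (w ℚ.* (y ℚ.- z)) (z ℚ.* (w ℚ.- x)))
          (ℚ.+-mono-< (mul< {w} {y ℚ.- z} 0<δ w<A yz)
                      (mul< {z} {w ℚ.- x} 0<δ z<B wx)))

  opaque
    mul-bounded : ∀ {f g} N A B → IsCauchy f → IsCauchy g → 0ℚ ℚ.< A → 0ℚ ℚ.< B →
                  (∀ n → N ℕ.≤ n → ℚ.∣ f n ∣ ℚ.< A) → (∀ n → N ℕ.≤ n → ℚ.∣ g n ∣ ℚ.< B) →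
                  IsCauchy (λ n → f n ℚ.* g n)
    mul-bounded {f} {g} L A B cf cg 0<A 0<B f<A g<B ε 0<ε
      with quotient (A ℚ.+ B) (ℚ.+-mono-< {0ℚ} {A} {0ℚ} {B} 0<A 0<B) 0<ε
    ... | δ , 0<δ , Cδ≡ε with cf δ 0<δ | cg δ 0<δ
    ... | M , closef | N , closeg = L ℕ.⊔ (M ℕ.⊔ N) , λ m n p q →
      let pMN = ⊔≤⇒≤ʳ L (M ℕ.⊔ N) p ; qMN = ⊔≤⇒≤ʳ L (M ℕ.⊔ N) q
      in subst (ℚ.∣ f m ℚ.* g m ℚ.- f n ℚ.* g n ∣ ℚ.<_) Cδ≡ε
        (mul-close (f m) (f n) (g m) (g n) 0<δ
          (f<A m (⊔≤⇒≤ˡ L (M ℕ.⊔ N) p)) (g<B n (⊔≤⇒≤ˡ L (M ℕ.⊔ N) q))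
          (closef m n (⊔≤⇒≤ˡ M N pMN) (⊔≤⇒≤ˡ M N qMN))
          (closeg m n (⊔≤⇒≤ʳ M N pMN) (⊔≤⇒≤ʳ M N qMN)))

  opaque
    const-cauchy : ∀ q → IsCauchy (λ _ → q)
    const-cauchy q ε 0<ε =
      0 , λ _ _ _ _ → subst (λ z → ℚ.∣ z ∣ ℚ.< ε) (sym (ℚ.+-inverseʳ q)) 0<ε

    +-cauchy : ∀ {f g} → IsCauchy f → IsCauchy g → IsCauchy (λ n → f n ℚ.+ g n)
    +-cauchy {f} {g} cf cg ε 0<ε
      with cf _ (half>0 0<ε) | cg _ (half>0 0<ε)
    ... | M , closef | N , closeg = M ℕ.⊔ N , λ m n p q →
      subst₂ (λ z w → ℚ.∣ z ∣ ℚ.< w)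
        (add-sub (f m) (f n) (g m) (g n))
        (half+half ε)
        (ℚ.≤-<-trans (ℚ.∣p+q∣≤∣p∣+∣q∣ (f m ℚ.- f n) (g m ℚ.- g n))
          (ℚ.+-mono-< (closef m n (⊔≤⇒≤ˡ M N p) (⊔≤⇒≤ˡ M N q))
                      (closeg m n (⊔≤⇒≤ʳ M N p) (⊔≤⇒≤ʳ M N q))))

    neg-cauchy : ∀ {f} → IsCauchy f → IsCauchy (λ n → ℚ.- f n)
    neg-cauchy {f} cf ε 0<ε with cf ε 0<ε
    ... | N , close = N , λ m n p q →
      subst (λ z → ℚ.∣ z ∣ ℚ.< ε)
        (neg-sub (f m) (f n))
        (close n m q p)

    *-cauchy : ∀ {f g} → IsCauchy f → IsCauchy g → IsCauchy (λ n → f n ℚ.* g n)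
    *-cauchy {f} {g} cf cg with bound {f} cf | bound {g} cg
    ... | A , 0<A , K , f<A | B , 0<B , L , g<B =
      mul-bounded {f} {g} (K ℕ.⊔ L) A B cf cg 0<A 0<B
        (λ n p → f<A n (⊔≤⇒≤ˡ K L p)) (λ n p → g<B n (⊔≤⇒≤ʳ K L p))

infixl 6 _+ᵣ_ _-ᵣ_
infixl 7 _*ᵣ_
infix  8 -ᵣ_

fromℚ : ℚ → ℝ
fromℚ q = mkℝ (λ _ → q) (const-cauchy q)

fromℕ : ℕ → ℝ
fromℕ n = fromℚ (+ n ℚ./ 1)

0ᵣ 1ᵣ ½ᵣ : ℝ
0ᵣ = fromℚ 0ℚ
1ᵣ = fromℚ 1ℚ
½ᵣ = fromℚ ½

_+ᵣ_ : ℝ → ℝ → ℝ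
x +ᵣ y = mkℝ (λ n → seq x n ℚ.+ seq y n) (+-cauchy {seq x} {seq y} (cauchy x) (cauchy y))

-ᵣ_ : ℝ → ℝ
-ᵣ x = mkℝ (λ n → ℚ.- seq x n) (neg-cauchy {seq x} (cauchy x))

_-ᵣ_ : ℝ → ℝ → ℝ
x -ᵣ y = x +ᵣ (-ᵣ y)

_*ᵣ_ : ℝ → ℝ → ℝ
x *ᵣ y = mkℝ (λ n → seq x n ℚ.* seq y n) (*-cauchy {seq x} {seq y} (cauchy x) (cauchy y))

------------------------------------------------------------------------
-- Extended reals as lower cuts.  The cut of x ∈ [-∞,∞] is {q ∈ ℚ : q < x},
-- so ∞ is the cut containing every rational.  Unlike the Cauchy reals, the
-- cuts are constructively closed under arbitrary suprema and infima.

infix 4 _∈_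

record LowerCut : Set₁ where
  field
    Below        : ℚ → Set
    below-closed : ∀ {p q} → p ℚ.< q → Below q → Below p
    below-open   : ∀ {q} → Below q → ∃[ r ] (q ℚ.< r × Below r)
open LowerCut public

_∈_ : ℚ → LowerCut → Set
q ∈ U = Below U q

sup : (ℕ → ℝ) → LowerCut
sup s = record
  { Below        = λ q → ∃[ N ] (fromℚ q <ᵣ s N)
  ; below-closed = λ { {p} {q} p<q (N , ε , 0<ε , M , h) →
      N , ε , 0<ε , M , λ n M≤n →
        ℚ.≤-trans (ℚ.+-mono-≤ (ℚ.<⇒≤ p<q) (ℚ.≤-refl {ε})) (h n M≤n) }
  ; below-open   = λ { {q} (N , ε , 0<ε , M , h) →
      q ℚ.+ ½ ℚ.* ε
      , subst (ℚ._< q ℚ.+ ½ ℚ.* ε) (ℚ.+-identityʳ q)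
          (ℚ.+-mono-≤-< (ℚ.≤-refl {q}) (half>0 0<ε))
      , N , ½ ℚ.* ε , half>0 0<ε , M , λ n M≤n →
        subst (ℚ._≤ seq (s N) n)
          (trans (cong (q ℚ.+_) (sym (half+half ε)))
                 (sym (ℚ.+-assoc q (½ ℚ.* ε) (½ ℚ.* ε))))
          (h n M≤n) }
  }

-- q < inf f requires a uniform gap: some r > q below every f i.
inf : {I : Set} → (I → LowerCut) → LowerCut
inf f = record
  { Below        = λ q → ∃[ r ] (q ℚ.< r × (∀ i → r ∈ f i))
  ; below-closed = λ { p<q (r , q<r , h) → r , ℚ.<-trans p<q q<r , h }
  ; below-open   = λ { (r , q<r , h) →
      let m , q<m , m<r = ℚ.<-dense q<r in m , q<m , r , m<r , h }
  }

infix 4 _≤ₗ_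

_≤ₗ_ : ℝ → LowerCut → Set
x ≤ₗ U = ∀ q → fromℚ q <ᵣ x → q ∈ U

------------------------------------------------------------------------

record Strategy : Set where
  field
    a    : ℕ → ℝ
    0≤a  : ∀ i → 0ᵣ ≤ᵣ a i
    a≤1  : ∀ i → a i ≤ᵣ 1ᵣ
    a₀≃½ : a 0 ≃ᵣ ½ᵣ

signed : Strategy → ℤ → ℝ
signed 𝒶 (+ i)    = Strategy.a 𝒶 i
signed 𝒶 -[1+ i ] = 1ᵣ -ᵣ Strategy.a 𝒶 (suc i)

data Step : Set where
  up down : Step

move : Step → ℤ → ℤ
move up   k = ℤ.suc k
move down k = ℤ.pred k

stepProb : Strategy → ℤ → Step → ℝ
stepProb 𝒶 k up   = signed 𝒶 k
stepProb 𝒶 k down = 1ᵣ -ᵣ signed 𝒶 k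

-- The first n steps from k determine the positions at times 0, …, n.
positions : ∀ {n} → ℤ → Vec Step n → Vec ℤ (suc n)
positions k []       = k ∷ []
positions k (s ∷ ss) = k ∷ positions (move s k) ss

pathProb : ∀ {n} → Strategy → ℤ → Vec Step n → ℝ
pathProb 𝒶 k []       = 1ᵣ
pathProb 𝒶 k (s ∷ ss) = stepProb 𝒶 k s *ᵣ pathProb 𝒶 (move s k) ss

∑paths : ∀ n → (Vec Step n → ℝ) → ℝ
∑paths zero    f = f []
∑paths (suc n) f = ∑paths n (λ ss → f (up ∷ ss)) +ᵣ ∑paths n (λ ss → f (down ∷ ss))

-- Expectation of a functional of the first n steps of two independent chains,
-- both started at 0.
𝔼 : Strategy → ∀ n → (Vec Step n → Vec Step n → ℝ) → ℝ
𝔼 𝒶 n F = ∑paths n λ ss → ∑paths n λ us →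
  pathProb 𝒶 (+ 0) ss *ᵣ pathProb 𝒶 (+ 0) us *ᵣ F ss us

------------------------------------------------------------------------

-- The least index t with x_t = y_t + 2d, if any.
firstMeeting : ∀ {m} → ℕ → Vec ℤ m → Vec ℤ m → Maybe ℕ
firstMeeting d []       []       = nothing
firstMeeting d (x ∷ xs) (y ∷ ys) =
  if does (x ℤ.≟ y ℤ.+ + (2 ℕ.* d))
  then just 0
  else Maybe.map suc (firstMeeting d xs ys)

-- min(𝒯_d, n), which depends only on the positions up to time n.
truncatedTime : ∀ {n} → ℕ → Vec Step n → Vec Step n → ℕ
truncatedTime {n} d ss us =
  fromMaybe n (firstMeeting d (positions (+ 0) ss) (positions (+ 0) us))

-- The expectation of the [0,∞]-valued variable 𝒯_d is sup_n 𝔼[min(𝒯_d, n)], by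
-- monotone convergence; it is ∞ if 𝒯_d = ∞ with positive probability.
expectedTime : ℕ → Strategy → LowerCut
expectedTime d 𝒶 = sup λ n → 𝔼 𝒶 n λ ss us → fromℕ (truncatedTime d ss us)

R : ℕ → LowerCut
R d = inf (expectedTime d)

{-# OPTIONS --safe #-}

-- Until time N = d², an agent has reached +d with probability at most 3/4.  By
-- symmetry this follows once p, the probability that the chain started at −d
-- reaches d within N steps, is at most 1/2.  The chain from any state of [−d,d)
-- reaches d within N steps with probability at least p, so the expected drop of
-- the occupation time V across the edges of [−d,d) satisfies a flow inequality
-- with source p at every vertex.  Weighting the edges {i,i+1} and {−i−1,−i} by
-- the same conductance c i (the chain is symmetric), the drops over both edges
-- sum to at least 2p C / c i with C = ∑ c i, and AM-GM gives 2p d² ≤ V(−d) ≤ N.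
-- A meeting requires agent X to reach +d or agent Y to reach −d, and by
-- independence neither happens before N with probability at least 1/16.
module Submission where

open import Defs
open import Data.Nat.Base using (ℕ; _≤_; _^_)
open import Data.Product.Base using (Σ-syntax; _×_)
open import Data.Bool.Base using (Bool; true; false; if_then_else_; _∧_)
open import Data.Integer.Base as ℤ using (ℤ; +_; -[1+_])
import Data.Integer.Properties as ℤ
open import Data.Maybe.Base using (nothing)
open import Data.Nat.Base as ℕ using (zero; suc)
import Data.Nat.Coprimality as Coprimality
import Data.Nat.Properties as ℕ
open import Data.Product.Base using (_,_; ∃-syntax)
open import Data.Rational.Base as ℚ using (ℚ; 0ℚ; 1ℚ; ½; mkℚ)
import Data.Rational.Properties as ℚ
open import Data.Rational.Solver using (module +-*-Solver)
open import Data.Sum.Base using (inj₁; inj₂)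
open import Data.Vec.Base using (Vec; []; _∷_)
open import Relation.Binary.PropositionalEquality
open import Relation.Nullary using (¬_; yes; no; does; contradiction)
open import Relation.Nullary.Decidable using (dec-true; dec-false)
open +-*-Solver using (solve; con; _:=_; _:+_; _:*_; _:-_; :-_)

-- Ordered arithmetic of ℚ

opaque
  0≤gap : ∀ {x y} → x ℚ.≤ y → 0ℚ ℚ.≤ y ℚ.- x
  0≤gap {x} {y} x≤y = subst (ℚ._≤ y ℚ.- x) (ℚ.+-inverseʳ x) (ℚ.+-monoˡ-≤ (ℚ.- x) x≤y)

  ≤-by-gap : ∀ {x y z} → 0ℚ ℚ.≤ z → z ≡ y ℚ.- x → x ℚ.≤ y
  ≤-by-gap {x} {y} 0≤z refl = subst₂ ℚ._≤_ (ℚ.+-identityˡ x)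
    (solve 2 (λ x y → (y :- x) :+ x := y) refl x y) (ℚ.+-monoˡ-≤ x 0≤z)

  +-nonNeg : ∀ {x y} → 0ℚ ℚ.≤ x → 0ℚ ℚ.≤ y → 0ℚ ℚ.≤ x ℚ.+ y
  +-nonNeg {x} {y} 0≤x 0≤y = ℚ.+-mono-≤ 0≤x 0≤y

  p≤x+p : ∀ {x} p → 0ℚ ℚ.≤ x → p ℚ.≤ x ℚ.+ p
  p≤x+p {x} p 0≤x = subst (ℚ._≤ x ℚ.+ p) (ℚ.+-identityˡ p) (ℚ.+-monoˡ-≤ p 0≤x)

  *-nonNeg : ∀ {x y} → 0ℚ ℚ.≤ x → 0ℚ ℚ.≤ y → 0ℚ ℚ.≤ x ℚ.* y
  *-nonNeg {x} {y} 0≤x 0≤y = subst (ℚ._≤ x ℚ.* y) (ℚ.*-zeroʳ x)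
    (ℚ.*-monoˡ-≤-nonNeg x {{ℚ.nonNegative 0≤x}} 0≤y)

  *-pos : ∀ {x y} → 0ℚ ℚ.< x → 0ℚ ℚ.< y → 0ℚ ℚ.< x ℚ.* y
  *-pos {x} {y} 0<x 0<y = subst (ℚ._< x ℚ.* y) (ℚ.*-zeroʳ x)
    (ℚ.*-monoʳ-<-pos x {{ℚ.positive 0<x}} 0<y)

  square-nonNeg : ∀ x → 0ℚ ℚ.≤ x ℚ.* x
  square-nonNeg x with ℚ.≤-total 0ℚ x
  ... | inj₁ 0≤x = *-nonNeg 0≤x 0≤x
  ... | inj₂ x≤0 = subst (0ℚ ℚ.≤_) (solve 1 (λ x → (:- x) :* (:- x) := x :* x) refl x)
                     (*-nonNeg (ℚ.neg-antimono-≤ x≤0) (ℚ.neg-antimono-≤ x≤0))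

  cancelˡ : ∀ {x y z} → 0ℚ ℚ.< z → z ℚ.* x ℚ.≤ z ℚ.* y → x ℚ.≤ y
  cancelˡ {z = z} 0<z = ℚ.*-cancelˡ-≤-pos z {{ℚ.positive 0<z}}

  positive-factor : ∀ {x y} → 0ℚ ℚ.≤ x → 0ℚ ℚ.< x ℚ.* y → 0ℚ ℚ.< x
  positive-factor {x} {y} 0≤x 0<xy = ℚ.≰⇒> λ x≤0 → ℚ.<⇒≢ 0<xy
    (sym (trans (cong (ℚ._* y) (ℚ.≤-antisym x≤0 0≤x)) (ℚ.*-zeroˡ y)))

  -- The junk value of the reciprocal at 0 is 0.
  recip : ℚ → ℚ
  recip x with x ℚ.≟ 0ℚ
  ... | yes _ = 0ℚ
  ... | no x≢0 = ℚ.1/_ x {{ℚ.≢-nonZero x≢0}}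

  *-recip : ∀ {x} → 0ℚ ℚ.< x → x ℚ.* recip x ≡ 1ℚ
  *-recip {x} 0<x with x ℚ.≟ 0ℚ
  ... | yes x≡0 = contradiction (sym x≡0) (ℚ.<⇒≢ 0<x)
  ... | no x≢0 = ℚ.*-inverseʳ x {{ℚ.≢-nonZero x≢0}}

  recip-pos : ∀ {x} → 0ℚ ℚ.< x → 0ℚ ℚ.< recip x
  recip-pos {x} 0<x with x ℚ.≟ 0ℚ
  ... | yes x≡0 = contradiction (sym x≡0) (ℚ.<⇒≢ 0<x)
  ... | no x≢0 = ℚ.positive⁻¹ (ℚ.1/_ x {{ℚ.≢-nonZero x≢0}}) {{ℚ.1/pos⇒pos x {{ℚ.positive 0<x}}}}

∑< : ℕ → (ℕ → ℚ) → ℚ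
∑< zero    f = 0ℚ
∑< (suc n) f = ∑< n f ℚ.+ f n

-- A sum of ones instead of a cast, so that `V≤t` is a termwise comparison of two sums.
natℚ : ℕ → ℚ
natℚ n = ∑< n (λ _ → 1ℚ)

opaque
  -- Adds κ times the vertex inequality to the bound for the inner edge, whose conductance is (1 -
  -- A)κ. The source pκ splits over both edges at the vertex, which is how the factor 2p in front of
  -- the sum arises.
  right-flow-step : ∀ A κ r r′ p S → 0ℚ ℚ.≤ κ →
    (1ℚ ℚ.- A) ℚ.* r ℚ.+ p ℚ.≤ A ℚ.* r′ →
    p ℚ.* ((1ℚ ℚ.- A) ℚ.* κ) ℚ.+ (p ℚ.+ p) ℚ.* S ℚ.≤ ((1ℚ ℚ.- A) ℚ.* κ) ℚ.* r →
    p ℚ.* (A ℚ.* κ) ℚ.+ (p ℚ.+ p) ℚ.* (S ℚ.+ (1ℚ ℚ.- A) ℚ.* κ) ℚ.≤ (A ℚ.* κ) ℚ.* r′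
  right-flow-step A κ r r′ p S 0≤κ h k =
    ≤-by-gap (+-nonNeg (*-nonNeg 0≤κ (0≤gap h)) (0≤gap k))
    (solve 6 (λ A κ r r′ p S →
        κ :* (A :* r′ :- ((con 1ℚ :- A) :* r :+ p))
          :+ (((con 1ℚ :- A) :* κ) :* r :- (p :* ((con 1ℚ :- A) :* κ) :+ (p :+ p) :* S))
        := (A :* κ) :* r′
             :- (p :* (A :* κ) :+ (p :+ p) :* (S :+ (con 1ℚ :- A) :* κ)))
      refl A κ r r′ p S)

  -- The mirror step, from the outer edge to the inner one. `T` stands for 2p times the sum of all
  -- conductances, which the induction carries unchanged.
  left-flow-step : ∀ A κ s s′ p S T → 0ℚ ℚ.≤ κ →
    A ℚ.* s′ ℚ.+ p ℚ.≤ (1ℚ ℚ.- A) ℚ.* s →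
    T ℚ.≤ (A ℚ.* κ) ℚ.* s′ ℚ.+ (p ℚ.* (A ℚ.* κ)
            ℚ.+ (p ℚ.+ p) ℚ.* (S ℚ.+ (1ℚ ℚ.- A) ℚ.* κ)) →
    T ℚ.≤ ((1ℚ ℚ.- A) ℚ.* κ) ℚ.* s ℚ.+ (p ℚ.* ((1ℚ ℚ.- A) ℚ.* κ) ℚ.+ (p ℚ.+ p) ℚ.* S)
  left-flow-step A κ s s′ p S T 0≤κ h k =
    ≤-by-gap (+-nonNeg (*-nonNeg 0≤κ (0≤gap h)) (0≤gap k))
    (solve 7 (λ A κ s s′ p S T →
        κ :* ((con 1ℚ :- A) :* s :- (A :* s′ :+ p))
          :+ ((A :* κ) :* s′ :+ (p :* (A :* κ) :+ (p :+ p) :* (S :+ (con 1ℚ :- A) :* κ)) :- T)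
        := ((con 1ℚ :- A) :* κ) :* s
             :+ (p :* ((con 1ℚ :- A) :* κ) :+ (p :+ p) :* S) :- T)
      refl A κ s s′ p S T)

-- Flows on a symmetric path

opaque
  -- Mirror edges share the conductance `c`, so the partial-sum term of one bound reappears on the
  -- opposite side of the other and cancels on addition.
  combine-flows : ∀ c p S T r s →
    p ℚ.* c ℚ.+ (p ℚ.+ p) ℚ.* S ℚ.≤ c ℚ.* r →
    (p ℚ.+ p) ℚ.* T ℚ.≤ c ℚ.* s ℚ.+ (p ℚ.* c ℚ.+ (p ℚ.+ p) ℚ.* S) →
    (p ℚ.+ p) ℚ.* T ℚ.≤ c ℚ.* (r ℚ.+ s)
  combine-flows c p S T r s h k = ≤-by-gap (+-nonNeg (0≤gap h) (0≤gap k))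
    (solve 6 (λ c p S T r s →
      (c :* r :- (p :* c :+ (p :+ p) :* S))
        :+ (c :* s :+ (p :* c :+ (p :+ p) :* S) :- (p :+ p) :* T)
      := c :* (r :+ s) :- (p :+ p) :* T) refl c p S T r s)

  -- AM-GM in the form C/c ≥ 2n - n²c/C.
  tangent : ∀ c C n p w → 0ℚ ℚ.< c → 0ℚ ℚ.≤ C → 0ℚ ℚ.≤ p →
    (p ℚ.+ p) ℚ.* C ℚ.≤ c ℚ.* w →
    (p ℚ.+ p) ℚ.* (n ℚ.* C ℚ.+ n ℚ.* C ℚ.- n ℚ.* n ℚ.* c) ℚ.≤ C ℚ.* w
  tangent c C n p w 0<c 0≤C 0≤p h = cancelˡ 0<c
    (≤-by-gap (+-nonNeg (*-nonNeg 0≤C (0≤gap h))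
                        (*-nonNeg (+-nonNeg 0≤p 0≤p) (square-nonNeg (C ℚ.- n ℚ.* c))))
      (solve 5 (λ c C n p w →
        C :* (c :* w :- (p :+ p) :* C) :+ (p :+ p) :* ((C :- n :* c) :* (C :- n :* c))
        := c :* (C :* w) :- c :* ((p :+ p) :* (n :* C :+ n :* C :- n :* n :* c)))
        refl c C n p w))

  tangent-sum-step : ∀ C n p ν S W c w →
    (p ℚ.+ p) ℚ.* (ν ℚ.* (n ℚ.* C ℚ.+ n ℚ.* C) ℚ.- n ℚ.* n ℚ.* S) ℚ.≤ C ℚ.* W →
    (p ℚ.+ p) ℚ.* (n ℚ.* C ℚ.+ n ℚ.* C ℚ.- n ℚ.* n ℚ.* c) ℚ.≤ C ℚ.* w →
    (p ℚ.+ p) ℚ.* ((ν ℚ.+ 1ℚ) ℚ.* (n ℚ.* C ℚ.+ n ℚ.* C) ℚ.- n ℚ.* n ℚ.* (S ℚ.+ c))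
      ℚ.≤ C ℚ.* (W ℚ.+ w)
  tangent-sum-step C n p ν S W c w h k = ≤-by-gap (+-nonNeg (0≤gap h) (0≤gap k))
    (solve 8 (λ C n p ν S W c w →
      (C :* W :- (p :+ p) :* (ν :* (n :* C :+ n :* C) :- n :* n :* S))
      :+ (C :* w :- (p :+ p) :* (n :* C :+ n :* C :- n :* n :* c))
      := C :* (W :+ w) :-
         (p :+ p) :* ((ν :+ con 1ℚ) :* (n :* C :+ n :* C) :- n :* n :* (S :+ c)))
      refl C n p ν S W c w)

  tangent-sum-total : ∀ C n p →
    (p ℚ.+ p) ℚ.* (n ℚ.* (n ℚ.* C ℚ.+ n ℚ.* C) ℚ.- n ℚ.* n ℚ.* C)
      ≡ C ℚ.* ((p ℚ.+ p) ℚ.* (n ℚ.* n))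
  tangent-sum-total = solve 3 (λ C n p →
    (p :+ p) :* (n :* (n :* C :+ n :* C) :- n :* n :* C)
      := C :* ((p :+ p) :* (n :* n))) refl

  tangent-sum-base : ∀ C n p →
    (p ℚ.+ p) ℚ.* (0ℚ ℚ.* (n ℚ.* C ℚ.+ n ℚ.* C) ℚ.- n ℚ.* n ℚ.* 0ℚ) ≡ C ℚ.* 0ℚ
  tangent-sum-base = solve 3 (λ C n p →
    (p :+ p) :* (con 0ℚ :* (n :* C :+ n :* C) :- n :* n :* con 0ℚ)
      := C :* con 0ℚ) refl

-- Indexing: A i is the outward probability at the vertices ±(i+1), r i lives on
-- the edge {i,i+1} and s i on the edge {−i−1,−i}.
module Flow
  (e : ℕ) {p : ℚ} (0<p : 0ℚ ℚ.< p) (A r s : ℕ → ℚ)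
  (0≤A : ∀ i → 0ℚ ℚ.≤ A i) (A≤1 : ∀ i → A i ℚ.≤ 1ℚ)
  (0≤r : ∀ i → 0ℚ ℚ.≤ r i) (0≤s : ∀ i → 0ℚ ℚ.≤ s i)
  (r-first : p ℚ.≤ r 0) (s-last : p ℚ.≤ s e)
  (r-step : ∀ i → i ℕ.< e → (1ℚ ℚ.- A i) ℚ.* r i ℚ.+ p ℚ.≤ A i ℚ.* r (suc i))
  (s-step : ∀ i → i ℕ.< e → A i ℚ.* s (suc i) ℚ.+ p ℚ.≤ (1ℚ ℚ.- A i) ℚ.* s i)
  where

  opaque
    0≤1-A : ∀ i → 0ℚ ℚ.≤ 1ℚ ℚ.- A i
    0≤1-A i = 0≤gap (A≤1 i)

    -- A strategy may take the values 0 and 1, but not here: the positive source `p` must leave the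
    -- vertex, outward by `r-step` and, in `0<1-A`, inward by `s-step`. Hence all conductances up to
    -- `c e` are positive.
    0<A : ∀ i → i ℕ.< e → 0ℚ ℚ.< A i
    0<A i i<e = positive-factor (0≤A i) (ℚ.<-≤-trans 0<p (ℚ.≤-trans
      (p≤x+p p (*-nonNeg (0≤1-A i) (0≤r i)))
      (r-step i i<e)))

    0<1-A : ∀ i → i ℕ.< e → 0ℚ ℚ.< 1ℚ ℚ.- A i
    0<1-A i i<e = positive-factor (0≤1-A i) (ℚ.<-≤-trans 0<p (ℚ.≤-trans
      (p≤x+p p (*-nonNeg (0≤A i) (0≤s (suc i))))
      (s-step i i<e)))

  -- Conductances of the reversible chain: c i and c (suc i) are the weights of
  -- the two edges at vertex suc i, and κ i is the sum of these two weights.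
  c κ : ℕ → ℚ
  c zero    = 1ℚ
  c (suc i) = A i ℚ.* κ i
  κ i = c i ℚ.* recip (1ℚ ℚ.- A i)

  opaque
    0<c : ∀ i → i ℕ.≤ e → 0ℚ ℚ.< c i
    0<c zero    _   = ℚ.positive⁻¹ 1ℚ
    0<c (suc i) i<e = *-pos (0<A i i<e)
      (*-pos (0<c i (ℕ.<⇒≤ i<e)) (recip-pos (0<1-A i i<e)))

    0≤κ : ∀ i → i ℕ.< e → 0ℚ ℚ.≤ κ i
    0≤κ i i<e = ℚ.<⇒≤ (*-pos (0<c i (ℕ.<⇒≤ i<e)) (recip-pos (0<1-A i i<e)))

    [1-A]κ≡c : ∀ i → i ℕ.< e → (1ℚ ℚ.- A i) ℚ.* κ i ≡ c i
    [1-A]κ≡c i i<e = begin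
      x ℚ.* (c i ℚ.* recip x)  ≡⟨ solve 3 (λ x y z → x :* (y :* z) := y :* (x :* z)) refl x (c i) (recip x) ⟩
      c i ℚ.* (x ℚ.* recip x)  ≡⟨ cong (c i ℚ.*_) (*-recip (0<1-A i i<e)) ⟩
      c i ℚ.* 1ℚ               ≡⟨ ℚ.*-identityʳ (c i) ⟩
      c i                      ∎
      where
      open ≡-Reasoning
      x : ℚ
      x = 1ℚ ℚ.- A i

    -- Induction outward. Each vertex `suc j` passed contributes p(c j + c (j+1)) and `r-first`
    -- contributes p c 0, so the edges before `i` count twice and edge `i` once.
    right-flow : ∀ i → i ℕ.≤ e → p ℚ.* c i ℚ.+ (p ℚ.+ p) ℚ.* ∑< i c ℚ.≤ c i ℚ.* r i
    right-flow zero    _   = ≤-by-gap (0≤gap r-first)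
      (solve 2 (λ p r → r :- p := con 1ℚ :* r :- (p :* con 1ℚ :+ (p :+ p) :* con 0ℚ))
        refl p (r 0))
    right-flow (suc i) i<e = subst
      (λ z → p ℚ.* c (suc i) ℚ.+ (p ℚ.+ p) ℚ.* (∑< i c ℚ.+ z) ℚ.≤ c (suc i) ℚ.* r (suc i))
      ([1-A]κ≡c i i<e)
      (right-flow-step (A i) (κ i) (r i) (r (suc i)) p (∑< i c) (0≤κ i i<e) (r-step i i<e)
        (subst (λ z → p ℚ.* z ℚ.+ (p ℚ.+ p) ℚ.* ∑< i c ℚ.≤ z ℚ.* r i)
          (sym ([1-A]κ≡c i i<e)) (right-flow i (ℕ.<⇒≤ i<e))))

    -- Induction inward from edge `e`, at distance `k`. The summand added to the weighted drop is
    -- exactly the left side of `right-flow`.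
    left-flow : ∀ k i → k ℕ.+ i ≡ e →
      (p ℚ.+ p) ℚ.* ∑< (suc e) c
        ℚ.≤ c i ℚ.* s i ℚ.+ (p ℚ.* c i ℚ.+ (p ℚ.+ p) ℚ.* ∑< i c)
    left-flow zero    i refl = ≤-by-gap
      (*-nonNeg (ℚ.<⇒≤ (0<c i ℕ.≤-refl)) (0≤gap s-last))
      (solve 4 (λ c s p S → c :* (s :- p)
          := c :* s :+ (p :* c :+ (p :+ p) :* S) :- (p :+ p) :* (S :+ c))
        refl (c i) (s i) p (∑< i c))
    left-flow (suc k) i refl = subst
      (λ z → (p ℚ.+ p) ℚ.* ∑< (suc e) c
               ℚ.≤ z ℚ.* s i ℚ.+ (p ℚ.* z ℚ.+ (p ℚ.+ p) ℚ.* ∑< i c))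
      ([1-A]κ≡c i i<e)
      (left-flow-step (A i) (κ i) (s i) (s (suc i)) p (∑< i c) _ (0≤κ i i<e) (s-step i i<e)
        (subst
          (λ z → (p ℚ.+ p) ℚ.* ∑< (suc e) c
            ℚ.≤ c (suc i) ℚ.* s (suc i) ℚ.+ (p ℚ.* c (suc i) ℚ.+ (p ℚ.+ p) ℚ.* (∑< i c ℚ.+ z)))
          (sym ([1-A]κ≡c i i<e))
          (left-flow k (suc i) (ℕ.+-suc k i))))
      where
      i<e : i ℕ.< e
      i<e = ℕ.s≤s (ℕ.m≤n+m i k)

    total-flow : ∀ i → i ℕ.≤ e → (p ℚ.+ p) ℚ.* ∑< (suc e) c ℚ.≤ c i ℚ.* (r i ℚ.+ s i)
    total-flow i i≤e = combine-flows (c i) p (∑< i c) (∑< (suc e) c) (r i) (s i)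
      (right-flow i i≤e) (left-flow (e ℕ.∸ i) i (ℕ.m∸n+n≡m i≤e))

    0<∑c : ∀ m → m ℕ.≤ e → 0ℚ ℚ.< ∑< (suc m) c
    0<∑c zero    m≤e = subst (0ℚ ℚ.<_) (sym (ℚ.+-identityˡ (c 0))) (0<c 0 m≤e)
    0<∑c (suc m) m≤e = ℚ.+-mono-< (0<∑c m (ℕ.<⇒≤ m≤e)) (0<c (suc m) m≤e)

    -- The tangent parameter `n` stays fixed while the number `m` of summands grows; both become e +
    -- 1 in `crossing-bound`, where 2n² - n² = n² remains.
    summed-flow : ∀ n m → m ℕ.≤ suc e → let C = ∑< (suc e) c in
      (p ℚ.+ p) ℚ.* (natℚ m ℚ.* (n ℚ.* C ℚ.+ n ℚ.* C) ℚ.- n ℚ.* n ℚ.* ∑< m c)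
        ℚ.≤ C ℚ.* ∑< m (λ i → r i ℚ.+ s i)
    summed-flow n zero    _   = ℚ.≤-reflexive (tangent-sum-base (∑< (suc e) c) n p)
    summed-flow n (suc m) m<  = tangent-sum-step _ n p (natℚ m) (∑< m c) _ (c m) _
      (summed-flow n m (ℕ.<⇒≤ m<))
      (tangent (c m) _ n p _ (0<c m (ℕ.s≤s⁻¹ m<)) (ℚ.<⇒≤ (0<∑c e ℕ.≤-refl)) (ℚ.<⇒≤ 0<p)
        (total-flow m (ℕ.s≤s⁻¹ m<)))

    crossing-bound : (p ℚ.+ p) ℚ.* (natℚ (suc e) ℚ.* natℚ (suc e))
                       ℚ.≤ ∑< (suc e) (λ i → r i ℚ.+ s i)
    crossing-bound = cancelˡ (0<∑c e ℕ.≤-refl)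
      (subst (ℚ._≤ ∑< (suc e) c ℚ.* ∑< (suc e) (λ i → r i ℚ.+ s i))
        (tangent-sum-total (∑< (suc e) c) (natℚ (suc e)) p)
        (summed-flow (natℚ (suc e)) (suc e) ℕ.≤-refl))

-- Hitting times of a birth–death chain

opaque
  0≤1 : 0ℚ ℚ.≤ 1ℚ
  0≤1 = ℚ.nonNegative⁻¹ 1ℚ

  0≤½ : 0ℚ ℚ.≤ ½
  0≤½ = ℚ.nonNegative⁻¹ ½

  convex-≤ : ∀ {b x y x′ y′} → 0ℚ ℚ.≤ b → b ℚ.≤ 1ℚ → x ℚ.≤ x′ → y ℚ.≤ y′ →
    b ℚ.* x ℚ.+ (1ℚ ℚ.- b) ℚ.* y ℚ.≤ b ℚ.* x′ ℚ.+ (1ℚ ℚ.- b) ℚ.* y′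
  convex-≤ {b} {x} {y} {x′} {y′} 0≤b b≤1 x≤x′ y≤y′ =
    ≤-by-gap (+-nonNeg (*-nonNeg 0≤b (0≤gap x≤x′)) (*-nonNeg (0≤gap b≤1) (0≤gap y≤y′)))
      (solve 5 (λ b x y x′ y′ → b :* (x′ :- x) :+ (con 1ℚ :- b) :* (y′ :- y)
        := b :* x′ :+ (con 1ℚ :- b) :* y′ :- (b :* x :+ (con 1ℚ :- b) :* y)) refl b x y x′ y′)

  convex-const : ∀ b x → b ℚ.* x ℚ.+ (1ℚ ℚ.- b) ℚ.* x ≡ x
  convex-const = solve 2 (λ b x → b :* x :+ (con 1ℚ :- b) :* x := x) refl

  ∑<-mono : ∀ n {f g} → (∀ i → f i ℚ.≤ g i) → ∑< n f ℚ.≤ ∑< n g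
  ∑<-mono zero    f≤g = ℚ.≤-refl
  ∑<-mono (suc n) f≤g = ℚ.+-mono-≤ (∑<-mono n f≤g) (f≤g n)

  ∑<-nonNeg : ∀ n {f} → (∀ i → 0ℚ ℚ.≤ f i) → 0ℚ ℚ.≤ ∑< n f
  ∑<-nonNeg zero    0≤f = ℚ.≤-refl
  ∑<-nonNeg (suc n) 0≤f = +-nonNeg (∑<-nonNeg n 0≤f) (0≤f n)

  antitone : ∀ {f : ℤ → ℚ} → (∀ k → f (ℤ.suc k) ℚ.≤ f k) → ∀ {j k} → j ℤ.≤ k → f k ℚ.≤ f j
  antitone {f} step {j} {k} j≤k = subst (λ z → f z ℚ.≤ f j) (begin
      + ℤ.∣ k ℤ.- j ∣ ℤ.+ j  ≡⟨ cong (λ z → z ℤ.+ j) (ℤ.0≤i⇒+∣i∣≡i (ℤ.i≤j⇒0≤j-i j≤k)) ⟩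
      (k ℤ.- j) ℤ.+ j        ≡⟨ ℤ.+-assoc k (ℤ.- j) j ⟩
      k ℤ.+ (ℤ.- j ℤ.+ j)    ≡⟨ cong (λ z → k ℤ.+ z) (ℤ.+-inverseˡ j) ⟩
      k ℤ.+ + 0              ≡⟨ ℤ.+-identityʳ k ⟩
      k                      ∎)
    (steps ℤ.∣ k ℤ.- j ∣)
    where
    open ≡-Reasoning
    steps : ∀ n → f (+ n ℤ.+ j) ℚ.≤ f j
    steps zero    = ℚ.≤-reflexive (cong f (ℤ.+-identityˡ j))
    steps (suc n) = subst (λ z → f z ℚ.≤ f j) (sym (ℤ.+-assoc (+ 1) (+ n) j))
      (ℚ.≤-trans (step (+ n ℤ.+ j)) (steps n))

  suc-neg : ∀ k → ℤ.suc (ℤ.- k) ≡ ℤ.- ℤ.pred k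
  suc-neg k = sym (ℤ.neg-distrib-+ ℤ.-1ℤ k)

  pred-neg : ∀ k → ℤ.pred (ℤ.- k) ≡ ℤ.- ℤ.suc k
  pred-neg k = sym (ℤ.neg-distrib-+ ℤ.1ℤ k)

  neg-suc⁻ : ∀ n → ℤ.suc -[1+ n ] ≡ ℤ.- + n
  neg-suc⁻ zero    = refl
  neg-suc⁻ (suc n) = refl

opaque
  -- The excess of v over its one-step average equals b(v - w) - (1 - b)(u - v), the outflow minus
  -- the inflow at the vertex.
  drop-step : ∀ b u v w p → p ℚ.≤ v ℚ.- (b ℚ.* w ℚ.+ (1ℚ ℚ.- b) ℚ.* u) →
    (1ℚ ℚ.- b) ℚ.* (u ℚ.- v) ℚ.+ p ℚ.≤ b ℚ.* (v ℚ.- w)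
  drop-step b u v w p h = ≤-by-gap (0≤gap h) (solve 5 (λ b u v w p →
    v :- (b :* w :+ (con 1ℚ :- b) :* u) :- p
      := b :* (v :- w) :- ((con 1ℚ :- b) :* (u :- v) :+ p)) refl b u v w p)

  occupation-step : ∀ b u v w u′ v′ w′ →
    (v ℚ.+ v′) ℚ.- (b ℚ.* (w ℚ.+ w′) ℚ.+ (1ℚ ℚ.- b) ℚ.* (u ℚ.+ u′))
      ≡ (v ℚ.- (b ℚ.* w ℚ.+ (1ℚ ℚ.- b) ℚ.* u))
          ℚ.+ (v′ ℚ.- (b ℚ.* w′ ℚ.+ (1ℚ ℚ.- b) ℚ.* u′))
  occupation-step = solve 7 (λ b u v w u′ v′ w′ →
    (v :+ v′) :- (b :* (w :+ w′) :+ (con 1ℚ :- b) :* (u :+ u′))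
      := (v :- (b :* w :+ (con 1ℚ :- b) :* u))
          :+ (v′ :- (b :* w′ :+ (con 1ℚ :- b) :* u′))) refl

  occupation-base : ∀ b → 0ℚ ℚ.- (b ℚ.* 0ℚ ℚ.+ (1ℚ ℚ.- b) ℚ.* 0ℚ) ≡ 1ℚ ℚ.- 1ℚ
  occupation-base = solve 1 (λ b →
    con 0ℚ :- (b :* con 0ℚ :+ (con 1ℚ :- b) :* con 0ℚ) := con 1ℚ :- con 1ℚ) refl

  sub-chain : ∀ x y z → (x ℚ.- y) ℚ.+ (y ℚ.- z) ≡ x ℚ.- z
  sub-chain = solve 3 (λ x y z → (x :- y) :+ (y :- z) := x :- z) refl

  1-[1-x] : ∀ x → 1ℚ ℚ.- (1ℚ ℚ.- x) ≡ x
  1-[1-x] = solve 1 (λ x → con 1ℚ :- (con 1ℚ :- x) := x) refl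

  fraction-≤ : ∀ {b x} → b ℚ.≤ 1ℚ → 0ℚ ℚ.≤ x → b ℚ.* x ℚ.≤ x
  fraction-≤ {b} {x} b≤1 0≤x = ≤-by-gap (*-nonNeg (0≤gap b≤1) 0≤x)
    (solve 2 (λ b x → (con 1ℚ :- b) :* x := x :- b :* x) refl b x)

  natℚ-+ : ∀ m n → natℚ (m ℕ.+ n) ≡ natℚ m ℚ.+ natℚ n
  natℚ-+ zero    n = sym (ℚ.+-identityˡ (natℚ n))
  natℚ-+ (suc m) n = trans (cong (ℚ._+ 1ℚ) (natℚ-+ m n))
    (solve 2 (λ x y → (x :+ y) :+ con 1ℚ := (x :+ con 1ℚ) :+ y) refl (natℚ m) (natℚ n))

  natℚ-* : ∀ m n → natℚ (m ℕ.* n) ≡ natℚ m ℚ.* natℚ n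
  natℚ-* zero    n = sym (ℚ.*-zeroˡ (natℚ n))
  natℚ-* (suc m) n = trans (natℚ-+ n (m ℕ.* n)) (trans (cong (natℚ n ℚ.+_) (natℚ-* m n))
    (solve 2 (λ x y → y :+ x :* y := (x :+ con 1ℚ) :* y) refl (natℚ m) (natℚ n)))

  natℚ-pos : ∀ n → 0ℚ ℚ.< natℚ (suc n)
  natℚ-pos n = ℚ.+-mono-≤-< (∑<-nonNeg n (λ _ → 0≤1)) (ℚ.positive⁻¹ 1ℚ)

module Chain (B : ℤ → ℚ) (0≤B : ∀ k → 0ℚ ℚ.≤ B k) (B≤1 : ∀ k → B k ℚ.≤ 1ℚ) where

  after : (ℤ → ℚ) → ℤ → ℚ
  after f k = B k ℚ.* f (ℤ.suc k) ℚ.+ (1ℚ ℚ.- B k) ℚ.* f (ℤ.pred k)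

  after-mono : ∀ {f g} → (∀ k → f k ℚ.≤ g k) → ∀ k → after f k ℚ.≤ after g k
  after-mono f≤g k = convex-≤ (0≤B k) (B≤1 k) (f≤g (ℤ.suc k)) (f≤g (ℤ.pred k))

  -- The probability that the chain from k visits only alive states at times 0, …, t.
  survival : (ℤ → Bool) → ℕ → ℤ → ℚ
  survival alive zero    k = if alive k then 1ℚ else 0ℚ
  survival alive (suc t) k = if alive k then after (survival alive t) k else 0ℚ

  module _ (alive : ℤ → Bool) where
    opaque
      survival-nonNeg : ∀ t k → 0ℚ ℚ.≤ survival alive t k
      survival-nonNeg zero k with alive k
      ... | true  = 0≤1
      ... | false = ℚ.≤-refl
      survival-nonNeg (suc t) k with alive k
      ... | true  = ℚ.≤-trans (ℚ.≤-reflexive (sym (convex-const (B k) 0ℚ)))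
                      (after-mono (survival-nonNeg t) k)
      ... | false = ℚ.≤-refl

      survival-suc-≤ : ∀ t k → survival alive (suc t) k ℚ.≤ survival alive t k
      survival-suc-≤ zero k with alive k
      ... | false = ℚ.≤-refl
      ... | true  = ℚ.≤-trans (after-mono below-1 k) (ℚ.≤-reflexive (convex-const (B k) 1ℚ))
        where
        below-1 : ∀ j → survival alive zero j ℚ.≤ 1ℚ
        below-1 j with alive j
        ... | true  = ℚ.≤-refl
        ... | false = 0≤1
      survival-suc-≤ (suc t) k with alive k
      ... | true  = after-mono (survival-suc-≤ t) k
      ... | false = ℚ.≤-refl

      survival≤1 : ∀ t k → survival alive t k ℚ.≤ 1ℚ
      survival≤1 zero k with alive k
      ... | true  = ℚ.≤-refl
      ... | false = 0≤1
      survival≤1 (suc t) k = ℚ.≤-trans (survival-suc-≤ t k) (survival≤1 t k)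

  -- Survival below a barrier and occupation time

  module Barrier (d : ℕ) where

    q : ℕ → ℤ → ℚ
    q = survival (λ k → does (k ℤ.<? + d))

    opaque
      q-start : ∀ {k} → k ℤ.< + d → q 0 k ≡ 1ℚ
      q-start {k} k<d rewrite dec-true (k ℤ.<? + d) k<d = refl

      q-inside : ∀ t {k} → k ℤ.< + d → q (suc t) k ≡ after (q t) k
      q-inside t {k} k<d rewrite dec-true (k ℤ.<? + d) k<d = refl

      q-outside : ∀ t {k} → ¬ k ℤ.< + d → q t k ≡ 0ℚ
      q-outside zero    {k} k≮d rewrite dec-false (k ℤ.<? + d) k≮d = refl
      q-outside (suc t) {k} k≮d rewrite dec-false (k ℤ.<? + d) k≮d = refl

      0≤q : ∀ t k → 0ℚ ℚ.≤ q t k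
      0≤q = survival-nonNeg _

      q≤1 : ∀ t k → q t k ℚ.≤ 1ℚ
      q≤1 = survival≤1 _

      suc-barrier : ∀ {k} → ¬ k ℤ.< + d → ¬ ℤ.suc k ℤ.< + d
      suc-barrier {k} k≮d = λ sk<d → k≮d (ℤ.≤-<-trans (ℤ.i≤suc[i] k) sk<d)

      -- Since the chain moves by unit steps, it must pass through suc k first.
      q-through : ∀ t → (∀ k → q t (ℤ.suc k) ℚ.≤ q t k) →
        ∀ k → q t (ℤ.suc k) ℚ.≤ q (suc t) k
      q-through t dec k with k ℤ.<? + d
      ... | no k≮d = ℚ.≤-reflexive (q-outside t (suc-barrier k≮d))
      ... | yes k<d = ℚ.≤-trans (ℚ.≤-reflexive (sym (convex-const (B k) _)))
        (convex-≤ (0≤B k) (B≤1 k) ℚ.≤-refl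
          (ℚ.≤-trans (dec k) (subst (λ z → q t z ℚ.≤ q t (ℤ.pred k)) (ℤ.suc-pred k)
            (dec (ℤ.pred k)))))

      -- The comparison passes through `q t (ℤ.suc k)`: dropping one time unit raises survival from
      -- `ℤ.suc k`, and `q-through` spends that unit on the way up from `k`.
      q-decreasing : ∀ t k → q t (ℤ.suc k) ℚ.≤ q t k
      q-decreasing zero k with k ℤ.<? + d
      ... | yes k<d = q≤1 0 (ℤ.suc k)
      ... | no k≮d = ℚ.≤-reflexive (q-outside 0 (suc-barrier k≮d))
      q-decreasing (suc t) k = ℚ.≤-trans (survival-suc-≤ _ t (ℤ.suc k))
        (q-through t (q-decreasing t) k)

      q-antitone : ∀ t {j k} → j ℤ.≤ k → q t k ℚ.≤ q t j
      q-antitone t = antitone (q-decreasing t)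

    -- 𝔼ₖ[min(t, τ)], where τ is the hitting time of the barrier.
    V : ℕ → ℤ → ℚ
    V t k = ∑< t (λ i → q i k)

    drop : ℕ → ℤ → ℚ
    drop t k = V t k ℚ.- V t (ℤ.suc k)

    opaque
      0≤drop : ∀ t k → 0ℚ ℚ.≤ drop t k
      0≤drop t k = 0≤gap (∑<-mono t (λ i → q-decreasing i k))

      -- Summing the one-step equation of `q` over time telescopes. As q 0 k = 1 here, the right
      -- side is the probability of reaching the barrier within `t` steps.
      V-equation : ∀ t {k} → k ℤ.< + d → V t k ℚ.- after (V t) k ≡ q 0 k ℚ.- q t k
      V-equation zero    {k} k<d = trans (occupation-base (B k))
        (cong₂ ℚ._-_ (sym (q-start k<d)) (sym (q-start k<d)))
      V-equation (suc t) {k} k<d = begin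
        V (suc t) k ℚ.- after (V (suc t)) k
          ≡⟨ occupation-step (B k) (V t (ℤ.pred k)) (V t k) (V t (ℤ.suc k))
               (q t (ℤ.pred k)) (q t k) (q t (ℤ.suc k)) ⟩
        (V t k ℚ.- after (V t) k) ℚ.+ (q t k ℚ.- after (q t) k)
          ≡⟨ cong₂ ℚ._+_ (V-equation t k<d) (cong (λ z → q t k ℚ.- z) (sym (q-inside t k<d))) ⟩
        (q 0 k ℚ.- q t k) ℚ.+ (q t k ℚ.- q (suc t) k)
          ≡⟨ sub-chain (q 0 k) (q t k) (q (suc t) k) ⟩
        q 0 k ℚ.- q (suc t) k
          ∎
        where open ≡-Reasoning

      V≤t : ∀ t k → V t k ℚ.≤ natℚ t
      V≤t t k = ∑<-mono t (λ i → q≤1 i k)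

      -- The true source at `k` is 1 - q t k; monotonicity of `q` lets the single value at `j` serve
      -- for every vertex from `j` up to the barrier.
      drop-flow : ∀ t {j k} → j ℤ.≤ k → k ℤ.< + d →
        (1ℚ ℚ.- B k) ℚ.* drop t (ℤ.pred k) ℚ.+ (1ℚ ℚ.- q t j) ℚ.≤ B k ℚ.* drop t k
      drop-flow t {j} {k} j≤k k<d = subst
        (λ z → (1ℚ ℚ.- B k) ℚ.* (V t (ℤ.pred k) ℚ.- V t z) ℚ.+ (1ℚ ℚ.- q t j) ℚ.≤ B k ℚ.* drop t k)
        (sym (ℤ.suc-pred k))
        (drop-step (B k) (V t (ℤ.pred k)) (V t k) (V t (ℤ.suc k)) (1ℚ ℚ.- q t j)
          (ℚ.≤-trans
            (ℚ.+-monoʳ-≤ 1ℚ (ℚ.neg-antimono-≤ (q-antitone t j≤k)))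
            (ℚ.≤-reflexive (sym (trans (V-equation t k<d) (cong (λ z → z ℚ.- q t k) (q-start k<d)))))))

      -- Obtained from `drop-flow` by discarding the inflow; it starts both inductions of `Flow`, as
      -- `r-first` and `s-last`.
      drop-lower : ∀ t {j k} → j ℤ.≤ k → k ℤ.< + d → 1ℚ ℚ.- q t j ℚ.≤ drop t k
      drop-lower t {j} {k} j≤k k<d = ℚ.≤-trans
        (p≤x+p (1ℚ ℚ.- q t j) (*-nonNeg (0≤gap (B≤1 k)) (0≤drop t (ℤ.pred k))))
        (ℚ.≤-trans (drop-flow t j≤k k<d) (fraction-≤ (B≤1 k) (0≤drop t k)))

      telescope : ∀ t n → ∑< n (λ i → drop t (+ i) ℚ.+ drop t -[1+ i ])
                            ≡ V t (ℤ.- + n) ℚ.- V t (+ n)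
      telescope t zero    = sym (ℚ.+-inverseʳ (V t (+ 0)))
      telescope t (suc n) = trans
        (cong₂ (λ x y → x ℚ.+ (drop t (+ n) ℚ.+ (V t -[1+ n ] ℚ.- V t y)))
          (telescope t n) (neg-suc⁻ n))
        (solve 4 (λ u v w x → (v :- w) :+ ((w :- x) :+ (u :- v)) := u :- x) refl
          (V t -[1+ n ]) (V t (ℤ.- + n)) (V t (+ n)) (V t (+ suc n)))

  -- Reflection-symmetric chains

  module Symmetric (B-neg : ∀ k → B (ℤ.- k) ≡ 1ℚ ℚ.- B k) where

    opaque
      -- Reflection swaps the two neighbours and `B-neg` swaps their weights.
      after-neg : ∀ f k → after f (ℤ.- k) ≡ after (λ j → f (ℤ.- j)) k
      after-neg f k
        rewrite B-neg k | 1-[1-x] (B k) | suc-neg k | pred-neg k =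
        ℚ.+-comm ((1ℚ ℚ.- B k) ℚ.* f (ℤ.- ℤ.pred k)) (B k ℚ.* f (ℤ.- ℤ.suc k))

    module _ (d : ℕ) where
      open Barrier d

      opaque
        -- A chain reaching ±d is at −d with probability at least one half.
        reflection : ∀ t k → q t (ℤ.- + d) ℚ.≤ q t k ℚ.+ q t (ℤ.- k)
        reflection t k with k ℤ.<? + d | ℤ.- k ℤ.<? + d
        ... | no k≮d | _ = ℚ.≤-trans (q-antitone t (ℤ.neg-mono-≤ (ℤ.≮⇒≥ k≮d)))
                             (p≤x+p _ (0≤q t k))
        ... | yes _ | no -k≮d = ℚ.≤-trans
          (q-antitone t (subst (ℤ._≤ ℤ.- + d) (ℤ.neg-involutive k) (ℤ.neg-mono-≤ (ℤ.≮⇒≥ -k≮d))))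
          (ℚ.≤-trans (p≤x+p _ (0≤q t (ℤ.- k))) (ℚ.≤-reflexive (ℚ.+-comm (q t (ℤ.- k)) (q t k))))
        reflection zero k | yes k<d | yes -k<d = ℚ.≤-trans (q≤1 0 (ℤ.- + d))
          (ℚ.≤-trans (p≤x+p 1ℚ 0≤1) (ℚ.≤-reflexive (sym (cong₂ ℚ._+_ (q-start k<d) (q-start -k<d)))))
        reflection (suc t) k | yes k<d | yes -k<d = begin
          q (suc t) (ℤ.- + d)
            ≤⟨ survival-suc-≤ _ t (ℤ.- + d) ⟩
          q t (ℤ.- + d)
            ≡⟨ convex-const (B k) _ ⟨
          B k ℚ.* q t (ℤ.- + d) ℚ.+ (1ℚ ℚ.- B k) ℚ.* q t (ℤ.- + d)
            ≤⟨ convex-≤ (0≤B k) (B≤1 k) (reflection t (ℤ.suc k)) (reflection t (ℤ.pred k)) ⟩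
          after (λ j → q t j ℚ.+ q t (ℤ.- j)) k
            ≡⟨ solve 5 (λ b u v w x → b :* (u :+ v) :+ (con 1ℚ :- b) :* (w :+ x)
                 := (b :* u :+ (con 1ℚ :- b) :* w) :+ (b :* v :+ (con 1ℚ :- b) :* x))
                 refl (B k) _ _ _ _ ⟩
          after (q t) k ℚ.+ after (λ j → q t (ℤ.- j)) k
            ≡⟨ cong₂ ℚ._+_ (q-inside t k<d) (trans (q-inside t -k<d) (after-neg (q t) k)) ⟨
          q (suc t) k ℚ.+ q (suc t) (ℤ.- k)
            ∎
          where open ℚ.≤-Reasoning

    module _ (e N : ℕ) (N≡d² : natℚ N ≡ natℚ (suc e) ℚ.* natℚ (suc e)) where
      open Barrier (suc e)

      private
        A : ℕ → ℚ
        A i = B (+ suc i)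

      opaque
        -- Positivity of the source is assumed because `Flow` divides by conductances; `half≤q`
        -- treats the other case directly.
        crossing-improbable : 0ℚ ℚ.< 1ℚ ℚ.- q N (ℤ.- + suc e) →
          (1ℚ ℚ.- q N (ℤ.- + suc e)) ℚ.+ (1ℚ ℚ.- q N (ℤ.- + suc e)) ℚ.≤ 1ℚ
        crossing-improbable 0<p = cancelˡ (*-pos (natℚ-pos e) (natℚ-pos e)) (begin
          n² ℚ.* (p ℚ.+ p)          ≡⟨ ℚ.*-comm n² (p ℚ.+ p) ⟩
          (p ℚ.+ p) ℚ.* n²          ≤⟨ Flow.crossing-bound e 0<p A (λ i → drop N (+ i))
                                          (λ i → drop N -[1+ i ])
                                          (λ i → 0≤B (+ suc i)) (λ i → B≤1 (+ suc i))
                                          (λ i → 0≤drop N (+ i)) (λ i → 0≤drop N -[1+ i ])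
                                          (drop-lower N ℤ.-≤+ (ℤ.+<+ ℕ.z<s))
                                          (drop-lower N ℤ.≤-refl ℤ.-<+)
                                          outward inward ⟩
          ∑< (suc e) (λ i → drop N (+ i) ℚ.+ drop N -[1+ i ])
                                    ≡⟨ telescope N (suc e) ⟩
          V N -[1+ e ] ℚ.- V N (+ suc e)
                                    ≤⟨ ≤-by-gap 0≤V (solve 2 (λ x y → y := x :- (x :- y)) refl
                                         (V N -[1+ e ]) (V N (+ suc e))) ⟩
          V N -[1+ e ]              ≤⟨ V≤t N -[1+ e ] ⟩
          natℚ N                    ≡⟨ N≡d² ⟩
          n²                        ≡⟨ ℚ.*-identityʳ n² ⟨
          n² ℚ.* 1ℚ                 ∎)
          where
          open ℚ.≤-Reasoning

          p n² : ℚ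
          p = 1ℚ ℚ.- q N (ℤ.- + suc e)
          n² = natℚ (suc e) ℚ.* natℚ (suc e)

          0≤V : 0ℚ ℚ.≤ V N (+ suc e)
          0≤V = ∑<-nonNeg N (λ i → 0≤q i (+ suc e))

          outward : ∀ i → i ℕ.< e →
            (1ℚ ℚ.- A i) ℚ.* drop N (+ i) ℚ.+ p ℚ.≤ A i ℚ.* drop N (+ suc i)
          outward i i<e = drop-flow N ℤ.-≤+ (ℤ.+<+ (ℕ.s<s i<e))

          -- At the vertex -(i+1) a step up leads towards 0, so `B-neg` gives it the inward
          -- probability 1 - A i.
          inward : ∀ i → i ℕ.< e →
            A i ℚ.* drop N -[1+ suc i ] ℚ.+ p ℚ.≤ (1ℚ ℚ.- A i) ℚ.* drop N -[1+ i ]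
          inward i i<e = subst₂
            (λ x y → x ℚ.* drop N -[1+ suc i ] ℚ.+ p ℚ.≤ y ℚ.* drop N -[1+ i ])
            (trans (cong (λ z → 1ℚ ℚ.- z) (B-neg (+ suc i))) (1-[1-x] (A i)))
            (B-neg (+ suc i))
            (drop-flow N (ℤ.-≤- (ℕ.<⇒≤ i<e)) ℤ.-<+)

        half≤q : ½ ℚ.≤ q N (ℤ.- + suc e)
        half≤q with 0ℚ ℚ.<? 1ℚ ℚ.- q N (ℤ.- + suc e)
        ... | yes 0<p = ≤-by-gap (*-nonNeg 0≤½ (0≤gap (crossing-improbable 0<p)))
          (solve 1 (λ x → con ½ :* (con 1ℚ :- ((con 1ℚ :- x) :+ (con 1ℚ :- x))) := x :- con ½)
            refl (q N (ℤ.- + suc e)))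
        ... | no p≯0 = ≤-by-gap (+-nonNeg (0≤gap (ℚ.≮⇒≥ p≯0)) 0≤½)
          (solve 1 (λ x → (con 0ℚ :- (con 1ℚ :- x)) :+ con ½ := x :- con ½)
            refl (q N (ℤ.- + suc e)))

        -- At k = 0 the two terms of `reflection` coincide, so survival from 0 is at least half of
        -- that from -d.
        quarter≤q : ½ ℚ.* ½ ℚ.≤ q N (+ 0)
        quarter≤q = ≤-by-gap
          (+-nonNeg (*-nonNeg 0≤½ (0≤gap half≤q)) (*-nonNeg 0≤½ (0≤gap (reflection (suc e) N (+ 0)))))
          (solve 2 (λ x y → con ½ :* (x :- con ½) :+ con ½ :* (y :+ y :- x)
            := y :- con ½ :* con ½) refl (q N (ℤ.- + suc e)) (q N (+ 0)))

-- Path sums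

opaque
  natℚ≡/1 : ∀ n → natℚ n ≡ + n ℚ./ 1
  natℚ≡/1 zero    = refl
  natℚ≡/1 (suc n) = begin
    natℚ n ℚ.+ 1ℚ            ≡⟨ cong (ℚ._+ 1ℚ) (natℚ≡/1 n) ⟩
    + n ℚ./ 1 ℚ.+ 1ℚ         ≡⟨ cong (ℚ._+ 1ℚ) (ℚ.normalize-coprime coprime) ⟩
    mkℚ (+ n) 0 coprime ℚ.+ 1ℚ
      ≡⟨ cong (ℚ._/ 1) (trans (cong (ℤ._+ + 1) (ℤ.*-identityʳ (+ n))) (ℤ.+-comm (+ n) (+ 1))) ⟩
    + suc n ℚ./ 1            ∎
    where
    open ≡-Reasoning
    coprime : Coprimality.Coprime n 1
    coprime = Coprimality.sym (Coprimality.1-coprimeTo n)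

  0≤/1 : ∀ n → 0ℚ ℚ.≤ + n ℚ./ 1
  0≤/1 n = subst (0ℚ ℚ.≤_) (natℚ≡/1 n) (∑<-nonNeg n (λ _ → 0≤1))

-- The rational counterpart of `∑paths`: real addition is termwise, so `∑paths` read at one index of
-- its sequence is such a sum.
∑steps : ∀ n → (Vec Step n → ℚ) → ℚ
∑steps zero    f = f []
∑steps (suc n) f = ∑steps n (λ ss → f (up ∷ ss)) ℚ.+ ∑steps n (λ ss → f (down ∷ ss))

opaque
  seq-∑paths : ∀ n f m → seq (∑paths n f) m ≡ ∑steps n (λ ss → seq (f ss) m)
  seq-∑paths zero    f m = refl
  seq-∑paths (suc n) f m = cong₂ ℚ._+_ (seq-∑paths n _ m) (seq-∑paths n _ m)

  ∑steps-cong : ∀ n {f g} → (∀ ss → f ss ≡ g ss) → ∑steps n f ≡ ∑steps n g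
  ∑steps-cong zero    f≡g = f≡g []
  ∑steps-cong (suc n) f≡g =
    cong₂ ℚ._+_ (∑steps-cong n (λ ss → f≡g (up ∷ ss))) (∑steps-cong n (λ ss → f≡g (down ∷ ss)))

  ∑steps-mono : ∀ n {f g} → (∀ ss → f ss ℚ.≤ g ss) → ∑steps n f ℚ.≤ ∑steps n g
  ∑steps-mono zero    f≤g = f≤g []
  ∑steps-mono (suc n) f≤g =
    ℚ.+-mono-≤ (∑steps-mono n (λ ss → f≤g (up ∷ ss))) (∑steps-mono n (λ ss → f≤g (down ∷ ss)))

  ∑steps-* : ∀ n c f → ∑steps n (λ ss → c ℚ.* f ss) ≡ c ℚ.* ∑steps n f
  ∑steps-* zero    c f = refl
  ∑steps-* (suc n) c f = trans (cong₂ ℚ._+_ (∑steps-* n c _) (∑steps-* n c _))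
    (sym (ℚ.*-distribˡ-+ c _ _))

indicator : Bool → ℚ
indicator b = if b then 1ℚ else 0ℚ

allAlive : ∀ {n} → (ℤ → Bool) → ℤ → Vec Step n → Bool
allAlive alive k []       = alive k
allAlive alive k (s ∷ ss) = alive k ∧ allAlive alive (move s k) ss

opaque
  -- The hypotheses add up to x - y < 2d.
  no-meeting : ∀ {x y} d → x ℤ.< + d → ℤ.- y ℤ.< + d → x ≢ y ℤ.+ + (2 ℕ.* d)
  no-meeting {x} {y} d x<d -y<d x≡y+2d = ℤ.<-irrefl refl (begin-strict
    + (2 ℕ.* d)                       ≡⟨ ℤ.+-identityˡ (+ (2 ℕ.* d)) ⟨
    + 0 ℤ.+ + (2 ℕ.* d)               ≡⟨ cong (λ z → z ℤ.+ + (2 ℕ.* d)) (ℤ.+-inverseˡ y) ⟨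
    (ℤ.- y ℤ.+ y) ℤ.+ + (2 ℕ.* d)     ≡⟨ ℤ.+-assoc (ℤ.- y) y (+ (2 ℕ.* d)) ⟩
    ℤ.- y ℤ.+ (y ℤ.+ + (2 ℕ.* d))     ≡⟨ cong (λ z → ℤ.- y ℤ.+ z) x≡y+2d ⟨
    ℤ.- y ℤ.+ x                       <⟨ ℤ.+-mono-< -y<d x<d ⟩
    + d ℤ.+ + d                       ≡⟨ cong (λ z → + (d ℕ.+ z)) (ℕ.+-identityʳ d) ⟨
    + (2 ℕ.* d)                       ∎)
    where open ℤ.≤-Reasoning

-- The condition y > -d is phrased through `ℤ.- k`, making `rightOf` literally the reflection of
-- `leftOf`.
leftOf rightOf : ℕ → ℤ → Bool
leftOf  d k = does (k ℤ.<? + d)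
rightOf d k = does (ℤ.- k ℤ.<? + d)

opaque
  firstMeeting-nothing : ∀ {n} d x y (ss us : Vec Step n) →
    allAlive (leftOf d) x ss ≡ true → allAlive (rightOf d) y us ≡ true →
    firstMeeting d (positions x ss) (positions y us) ≡ nothing
  firstMeeting-nothing d x y [] [] p q with x ℤ.<? + d | ℤ.- y ℤ.<? + d
  ... | yes x<d | yes -y<d
    rewrite dec-false (x ℤ.≟ y ℤ.+ + (2 ℕ.* d)) (no-meeting d x<d -y<d) = refl
  firstMeeting-nothing d x y (s ∷ ss) (u ∷ us) p q with x ℤ.<? + d | ℤ.- y ℤ.<? + d
  ... | yes x<d | yes -y<d
    rewrite dec-false (x ℤ.≟ y ℤ.+ + (2 ℕ.* d)) (no-meeting d x<d -y<d)
          | firstMeeting-nothing d (move s x) (move u y) ss us p q = refl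

  -- If neither agent has crossed, no meeting is found and `truncatedTime` falls back on its default
  -- `n`; otherwise the left side is 0.
  truncatedTime-lower : ∀ {n} d (ss us : Vec Step n) →
    natℚ n ℚ.* (indicator (allAlive (leftOf d) (+ 0) ss)
                 ℚ.* indicator (allAlive (rightOf d) (+ 0) us))
      ℚ.≤ + truncatedTime d ss us ℚ./ 1
  truncatedTime-lower {n} d ss us with allAlive (leftOf d) (+ 0) ss in p | allAlive (rightOf d) (+ 0) us in q
  ... | true | true rewrite firstMeeting-nothing d (+ 0) (+ 0) ss us p q =
    ℚ.≤-reflexive (trans (ℚ.*-identityʳ (natℚ n)) (natℚ≡/1 n))
  ... | true  | false = ℚ.≤-trans (ℚ.≤-reflexive (ℚ.*-zeroʳ (natℚ n)))
    (0≤/1 (truncatedTime d ss us))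
  ... | false | b = ℚ.≤-trans
    (ℚ.≤-reflexive (trans (cong (natℚ n ℚ.*_) (ℚ.*-zeroˡ (indicator b))) (ℚ.*-zeroʳ (natℚ n))))
    (0≤/1 (truncatedTime d ss us))

module Approximant (𝒶 : Strategy) (m : ℕ)
  (0≤b : ∀ k → 0ℚ ℚ.≤ seq (signed 𝒶 k) m) (b≤1 : ∀ k → seq (signed 𝒶 k) m ℚ.≤ 1ℚ)
  (b-neg : ∀ k → seq (signed 𝒶 (ℤ.- k)) m ≡ 1ℚ ℚ.- seq (signed 𝒶 k) m)
  where

  open Chain (λ k → seq (signed 𝒶 k) m) 0≤b b≤1
  open Symmetric b-neg

  prob : ∀ {n} → ℤ → Vec Step n → ℚ
  prob k ss = seq (pathProb 𝒶 k ss) m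

  opaque
    0≤prob : ∀ {n} k (ss : Vec Step n) → 0ℚ ℚ.≤ prob k ss
    0≤prob k []          = 0≤1
    0≤prob k (up   ∷ ss) = *-nonNeg (0≤b k) (0≤prob (ℤ.suc k) ss)
    0≤prob k (down ∷ ss) = *-nonNeg (0≤gap (b≤1 k)) (0≤prob (ℤ.pred k) ss)

    -- First-step analysis: the first step's probability factors out of the path weight, and a dead
    -- start annihilates every summand.
    ∑steps-survival : ∀ alive n k →
      ∑steps n (λ ss → prob k ss ℚ.* indicator (allAlive alive k ss)) ≡ survival alive n k
    ∑steps-survival alive zero    k = ℚ.*-identityˡ (indicator (alive k))
    ∑steps-survival alive (suc n) k with alive k
    ... | true  = cong₂ ℚ._+_ (branch up) (branch down)
      where
      branch : ∀ s → ∑steps n (λ ss → seq (stepProb 𝒶 k s) m ℚ.* prob (move s k) ss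
                                        ℚ.* indicator (allAlive alive (move s k) ss))
                       ≡ seq (stepProb 𝒶 k s) m ℚ.* survival alive n (move s k)
      branch s = trans
        (∑steps-cong n (λ ss → ℚ.*-assoc (seq (stepProb 𝒶 k s) m) (prob (move s k) ss) _))
        (trans (∑steps-* n (seq (stepProb 𝒶 k s) m) _)
          (cong (seq (stepProb 𝒶 k s) m ℚ.*_) (∑steps-survival alive n (move s k))))
    ... | false = cong₂ ℚ._+_ (vanish up) (vanish down)
      where
      vanish : ∀ s → ∑steps n (λ ss → prob k (s ∷ ss) ℚ.* 0ℚ) ≡ 0ℚ
      vanish s = trans (∑steps-cong n (λ ss → trans (ℚ.*-zeroʳ (prob k (s ∷ ss)))
                                                  (sym (ℚ.*-zeroˡ (prob k (s ∷ ss))))))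
                   (trans (∑steps-* n 0ℚ (λ ss → prob k (s ∷ ss))) (ℚ.*-zeroˡ (∑steps n (λ ss → prob k (s ∷ ss)))))

    -- By symmetry of the chain; at 0 it gives both agents the same survival probability.
    survival-neg : ∀ d n k → survival (rightOf d) n k ≡ survival (leftOf d) n (ℤ.- k)
    survival-neg d zero    k = refl
    survival-neg d (suc n) k with ℤ.- k ℤ.<? + d
    ... | no  _ = refl
    ... | yes _ = trans
      (cong₂ (λ x y → seq (signed 𝒶 k) m ℚ.* x ℚ.+ (1ℚ ℚ.- seq (signed 𝒶 k) m) ℚ.* y)
        (survival-neg d n (ℤ.suc k)) (survival-neg d n (ℤ.pred k)))
      (sym (after-neg (survival (leftOf d) n) k))

    -- Independence enters here: path weights and indicators are products, so the double sum factors
    -- into the two survival probabilities.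
    𝔼-lower : ∀ d n → natℚ n ℚ.* (survival (leftOf d) n (+ 0) ℚ.* survival (leftOf d) n (+ 0))
                        ℚ.≤ seq (𝔼 𝒶 n (λ ss us → fromℕ (truncatedTime d ss us))) m
    𝔼-lower d n = begin
      ν ℚ.* (x ℚ.* x)
        ≡⟨ solve 2 (λ ν x → ν :* (x :* x) := (ν :* x) :* x) refl ν x ⟩
      (ν ℚ.* x) ℚ.* x
        ≡⟨ cong ((ν ℚ.* x) ℚ.*_) (∑steps-survival (leftOf d) n (+ 0)) ⟨
      (ν ℚ.* x) ℚ.* ∑steps n (λ ss → prob (+ 0) ss ℚ.* iˡ ss)
        ≡⟨ ∑steps-* n (ν ℚ.* x) _ ⟨
      ∑steps n (λ ss → (ν ℚ.* x) ℚ.* (prob (+ 0) ss ℚ.* iˡ ss))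
        ≡⟨ ∑steps-cong n (λ ss → inner ss) ⟩
      ∑steps n (λ ss → ∑steps n λ us →
        prob (+ 0) ss ℚ.* prob (+ 0) us ℚ.* (ν ℚ.* (iˡ ss ℚ.* iʳ us)))
        ≤⟨ ∑steps-mono n (λ ss → ∑steps-mono n λ us →
             ℚ.*-monoˡ-≤-nonNeg (prob (+ 0) ss ℚ.* prob (+ 0) us)
               {{ℚ.nonNegative (*-nonNeg (0≤prob (+ 0) ss) (0≤prob (+ 0) us))}}
               (truncatedTime-lower d ss us)) ⟩
      ∑steps n (λ ss → ∑steps n λ us →
        prob (+ 0) ss ℚ.* prob (+ 0) us ℚ.* (+ truncatedTime d ss us ℚ./ 1))
        ≡⟨ ∑steps-cong n (λ ss → seq-∑paths n _ m) ⟨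
      ∑steps n (λ ss → seq (∑paths n λ us →
        pathProb 𝒶 (+ 0) ss *ᵣ pathProb 𝒶 (+ 0) us *ᵣ fromℕ (truncatedTime d ss us)) m)
        ≡⟨ seq-∑paths n _ m ⟨
      seq (𝔼 𝒶 n (λ ss us → fromℕ (truncatedTime d ss us))) m
        ∎
      where
      open ℚ.≤-Reasoning

      ν x : ℚ
      ν = natℚ n
      x = survival (leftOf d) n (+ 0)

      iˡ iʳ : Vec Step n → ℚ
      iˡ ss = indicator (allAlive (leftOf d) (+ 0) ss)
      iʳ us = indicator (allAlive (rightOf d) (+ 0) us)

      inner : ∀ ss → (ν ℚ.* x) ℚ.* (prob (+ 0) ss ℚ.* iˡ ss)
        ≡ ∑steps n (λ us → prob (+ 0) ss ℚ.* prob (+ 0) us ℚ.* (ν ℚ.* (iˡ ss ℚ.* iʳ us)))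
      inner ss = sym (trans
        (∑steps-cong n (λ us → solve 5 (λ p q ν i j →
          p :* q :* (ν :* (i :* j)) := (ν :* p :* i) :* (q :* j)) refl
          (prob (+ 0) ss) (prob (+ 0) us) ν (iˡ ss) (iʳ us)))
        (trans (∑steps-* n (ν ℚ.* prob (+ 0) ss ℚ.* iˡ ss) _)
          (trans (cong (ν ℚ.* prob (+ 0) ss ℚ.* iˡ ss ℚ.*_)
              (trans (∑steps-survival (rightOf d) n (+ 0)) (survival-neg d n (+ 0))))
            (solve 4 (λ ν x p i → (ν :* p :* i) :* x := (ν :* x) :* (p :* i)) refl
              ν x (prob (+ 0) ss) (iˡ ss)))))

-- Passage to the reals

-- `x ≃ᵣ y` unfolds to `Null` of the termwise difference, so the congruence lemmas reduce to
-- arithmetic of null sequences.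
Null : (ℕ → ℚ) → Set
Null f = ∀ ε → 0ℚ ℚ.< ε → ∃[ N ] (∀ n → N ℕ.≤ n → ℚ.∣ f n ∣ ℚ.< ε)

opaque
  0<½ : 0ℚ ℚ.< ½
  0<½ = ℚ.positive⁻¹ ½

  ½ε+½ε : ∀ ε → ½ ℚ.* ε ℚ.+ ½ ℚ.* ε ≡ ε
  ½ε+½ε = solve 1 (λ ε → con ½ :* ε :+ con ½ :* ε := ε) refl

  ½ε<ε : ∀ {ε} → 0ℚ ℚ.< ε → ½ ℚ.* ε ℚ.< ε
  ½ε<ε {ε} 0<ε = subst₂ ℚ._<_ (ℚ.+-identityʳ (½ ℚ.* ε)) (½ε+½ε ε)
    (ℚ.+-monoʳ-< (½ ℚ.* ε) (*-pos 0<½ 0<ε))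

  ∣∣-lub : ∀ {x δ} → x ℚ.≤ δ → ℚ.- x ℚ.≤ δ → ℚ.∣ x ∣ ℚ.≤ δ
  ∣∣-lub {x} x≤δ -x≤δ with ℚ.∣p∣≡p∨∣p∣≡-p x
  ... | inj₁ ∣x∣≡x  = subst (ℚ._≤ _) (sym ∣x∣≡x) x≤δ
  ... | inj₂ ∣x∣≡-x = subst (ℚ._≤ _) (sym ∣x∣≡-x) -x≤δ

  -x≤∣x∣ : ∀ x → ℚ.- x ℚ.≤ ℚ.∣ x ∣
  -x≤∣x∣ x with ℚ.≤-total 0ℚ x
  ... | inj₁ 0≤x = ℚ.≤-trans (ℚ.neg-antimono-≤ 0≤x) (ℚ.0≤∣p∣ x)
  ... | inj₂ x≤0 = ℚ.≤-reflexive (trans (sym (ℚ.0≤p⇒∣p∣≡p (ℚ.neg-antimono-≤ x≤0))) (ℚ.∣-p∣≡∣p∣ x))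

  Null-cong : ∀ {f g} → (∀ n → f n ≡ g n) → Null f → Null g
  Null-cong f≡g f→0 ε 0<ε with f→0 ε 0<ε
  ... | N , small = N , λ n N≤n → subst (λ z → ℚ.∣ z ∣ ℚ.< ε) (f≡g n) (small n N≤n)

  Null-+ : ∀ {f g} → Null f → Null g → Null (λ n → f n ℚ.+ g n)
  Null-+ {f} {g} f→0 g→0 ε 0<ε
    with f→0 _ (*-pos 0<½ 0<ε) | g→0 _ (*-pos 0<½ 0<ε)
  ... | M , small-f | N , small-g = M ℕ.⊔ N , λ n M⊔N≤n →
    subst (ℚ.∣ f n ℚ.+ g n ∣ ℚ.<_) (½ε+½ε ε)
      (ℚ.≤-<-trans (ℚ.∣p+q∣≤∣p∣+∣q∣ (f n) (g n))
        (ℚ.+-mono-< (small-f n (ℕ.m⊔n≤o⇒m≤o M N M⊔N≤n)) (small-g n (ℕ.m⊔n≤o⇒n≤o M N M⊔N≤n))))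

  Null-neg : ∀ {f} → Null f → Null (λ n → ℚ.- f n)
  Null-neg {f} f→0 ε 0<ε with f→0 ε 0<ε
  ... | N , small = N , λ n N≤n → subst (ℚ._< ε) (sym (ℚ.∣-p∣≡∣p∣ (f n))) (small n N≤n)

  bounded : ∀ x → ∃[ B ] (0ℚ ℚ.< B × ∃[ N ] (∀ n → N ℕ.≤ n → ℚ.∣ seq x n ∣ ℚ.≤ B))
  bounded x with cauchy x 1ℚ (ℚ.positive⁻¹ 1ℚ)
  ... | N , close = 1ℚ ℚ.+ ℚ.∣ seq x N ∣
    , ℚ.+-mono-<-≤ (ℚ.positive⁻¹ 1ℚ) (ℚ.0≤∣p∣ (seq x N))
    , N
    , λ n N≤n → ℚ.≤-trans
        (subst (λ z → ℚ.∣ z ∣ ℚ.≤ ℚ.∣ seq x n ℚ.- seq x N ∣ ℚ.+ ℚ.∣ seq x N ∣)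
          (solve 2 (λ u v → (u :- v) :+ v := u) refl (seq x n) (seq x N))
          (ℚ.∣p+q∣≤∣p∣+∣q∣ (seq x n ℚ.- seq x N) (seq x N)))
        (ℚ.+-monoˡ-≤ ℚ.∣ seq x N ∣ (ℚ.<⇒≤ (close n N N≤n ℕ.≤-refl)))

opaque
  Null-* : ∀ {f} x → Null f → Null (λ n → seq x n ℚ.* f n)
  Null-* {f} x f→0 ε 0<ε with bounded x
  ... | B , 0<B , M , x≤B with f→0 (recip B ℚ.* ε) (*-pos (recip-pos 0<B) 0<ε)
  ... | N , small = M ℕ.⊔ N , λ n M⊔N≤n → begin-strict
    ℚ.∣ seq x n ℚ.* f n ∣
      ≡⟨ ℚ.∣p*q∣≡∣p∣*∣q∣ (seq x n) (f n) ⟩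
    ℚ.∣ seq x n ∣ ℚ.* ℚ.∣ f n ∣
      ≤⟨ ℚ.*-monoʳ-≤-nonNeg ℚ.∣ f n ∣ {{ℚ.∣-∣-nonNeg (f n)}} (x≤B n (ℕ.m⊔n≤o⇒m≤o M N M⊔N≤n)) ⟩
    B ℚ.* ℚ.∣ f n ∣
      <⟨ ℚ.*-monoʳ-<-pos B {{ℚ.positive 0<B}} (small n (ℕ.m⊔n≤o⇒n≤o M N M⊔N≤n)) ⟩
    B ℚ.* (recip B ℚ.* ε)
      ≡⟨ ℚ.*-assoc B (recip B) ε ⟨
    B ℚ.* recip B ℚ.* ε
      ≡⟨ cong (ℚ._* ε) (*-recip 0<B) ⟩
    1ℚ ℚ.* ε
      ≡⟨ ℚ.*-identityˡ ε ⟩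
    ε ∎
    where open ℚ.≤-Reasoning

opaque
  ≃ᵣ-refl : ∀ x → x ≃ᵣ x
  ≃ᵣ-refl x ε 0<ε = 0 , λ n _ →
    subst (λ z → ℚ.∣ z ∣ ℚ.< ε) (sym (ℚ.+-inverseʳ (seq x n))) 0<ε

  +ᵣ-cong : ∀ x x′ y y′ → x ≃ᵣ x′ → y ≃ᵣ y′ → x +ᵣ y ≃ᵣ x′ +ᵣ y′
  +ᵣ-cong x x′ y y′ x≃x′ y≃y′ = Null-cong
    (λ n → solve 4 (λ x x′ y y′ → (x :- x′) :+ (y :- y′) := (x :+ y) :- (x′ :+ y′)) refl
      (seq x n) (seq x′ n) (seq y n) (seq y′ n))
    (Null-+ x≃x′ y≃y′)

  -ᵣ-cong : ∀ x x′ → x ≃ᵣ x′ → -ᵣ x ≃ᵣ -ᵣ x′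
  -ᵣ-cong x x′ x≃x′ = Null-cong
    (λ n → ℚ.neg-distrib-+ (seq x n) (ℚ.- seq x′ n))
    (Null-neg x≃x′)

  *ᵣ-cong : ∀ x x′ y y′ → x ≃ᵣ x′ → y ≃ᵣ y′ → x *ᵣ y ≃ᵣ x′ *ᵣ y′
  *ᵣ-cong x x′ y y′ x≃x′ y≃y′ = Null-cong
    (λ n → solve 4 (λ x x′ y y′ → y :* (x :- x′) :+ x′ :* (y :- y′) := x :* y :- x′ :* y′) refl
      (seq x n) (seq x′ n) (seq y n) (seq y′ n))
    (Null-+ (Null-* y x≃x′) (Null-* x′ y≃y′))

opaque
  close⇒cauchy : ∀ x {g} → Null (λ n → g n ℚ.- seq x n) → IsCauchy g
  close⇒cauchy x {g} g≃x ε 0<ε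
    -- The error budget is ε/2 for the oscillation of `x` and ε/4 for each of the two distances from
    -- `g` to `x`.
    with cauchy x _ (*-pos 0<½ 0<ε) | g≃x _ (*-pos 0<½ (*-pos 0<½ 0<ε))
  ... | M , close-x | N , close-g = M ℕ.⊔ N , λ m n p q → begin-strict
    ℚ.∣ g m ℚ.- g n ∣
      ≡⟨ cong ℚ.∣_∣ (solve 4 (λ a b u v → a :- b := (u :- v) :+ ((a :- u) :- (b :- v))) refl
           (g m) (g n) (seq x m) (seq x n)) ⟩
    ℚ.∣ (seq x m ℚ.- seq x n) ℚ.+ ((g m ℚ.- seq x m) ℚ.- (g n ℚ.- seq x n)) ∣
      ≤⟨ ℚ.∣p+q∣≤∣p∣+∣q∣ (seq x m ℚ.- seq x n) ((g m ℚ.- seq x m) ℚ.- (g n ℚ.- seq x n)) ⟩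
    ℚ.∣ seq x m ℚ.- seq x n ∣ ℚ.+ ℚ.∣ (g m ℚ.- seq x m) ℚ.- (g n ℚ.- seq x n) ∣
      ≤⟨ ℚ.+-monoʳ-≤ ℚ.∣ seq x m ℚ.- seq x n ∣ (ℚ.∣p-q∣≤∣p∣+∣q∣ (g m ℚ.- seq x m) (g n ℚ.- seq x n)) ⟩
    ℚ.∣ seq x m ℚ.- seq x n ∣ ℚ.+ (ℚ.∣ g m ℚ.- seq x m ∣ ℚ.+ ℚ.∣ g n ℚ.- seq x n ∣)
      <⟨ ℚ.+-mono-< (close-x m n (ℕ.m⊔n≤o⇒m≤o M N p) (ℕ.m⊔n≤o⇒m≤o M N q))
           (ℚ.+-mono-< (close-g m (ℕ.m⊔n≤o⇒n≤o M N p)) (close-g n (ℕ.m⊔n≤o⇒n≤o M N q))) ⟩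
    ½ ℚ.* ε ℚ.+ (½ ℚ.* (½ ℚ.* ε) ℚ.+ ½ ℚ.* (½ ℚ.* ε))
      ≡⟨ cong (½ ℚ.* ε ℚ.+_) (½ε+½ε (½ ℚ.* ε)) ⟩
    ½ ℚ.* ε ℚ.+ ½ ℚ.* ε
      ≡⟨ ½ε+½ε ε ⟩
    ε ∎
    where open ℚ.≤-Reasoning

-- Clamping a strategy to exact rational approximants

clamp : ℚ → ℚ
clamp q = 0ℚ ℚ.⊔ (q ℚ.⊓ 1ℚ)

opaque
  0≤clamp : ∀ q → 0ℚ ℚ.≤ clamp q
  0≤clamp q = ℚ.p≤p⊔q 0ℚ (q ℚ.⊓ 1ℚ)

  clamp≤1 : ∀ q → clamp q ℚ.≤ 1ℚ
  clamp≤1 q = ℚ.⊔-lub 0≤1 (ℚ.p⊓q≤q q 1ℚ)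

  clamp-close : ∀ q {δ} → 0ℚ ℚ.≤ δ → 0ℚ ℚ.≤ q ℚ.+ δ → q ℚ.≤ 1ℚ ℚ.+ δ →
    ℚ.∣ clamp q ℚ.- q ∣ ℚ.≤ δ
  clamp-close q {δ} 0≤δ 0≤q+δ q≤1+δ = ∣∣-lub
    (≤-by-gap (0≤gap above) (solve 3 (λ q c δ → (q :+ δ) :- c := δ :- (c :- q)) refl q (clamp q) δ))
    (≤-by-gap (0≤gap below) (solve 3 (λ q c δ → c :- (q :- δ) := δ :- (:- (c :- q))) refl q (clamp q) δ))
    where
    above : clamp q ℚ.≤ q ℚ.+ δ
    above = ℚ.⊔-lub 0≤q+δ (ℚ.≤-trans (ℚ.p⊓q≤p q 1ℚ)
      (≤-by-gap 0≤δ (solve 2 (λ q δ → δ := (q :+ δ) :- q) refl q δ)))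

    below : q ℚ.- δ ℚ.≤ clamp q
    below = ℚ.≤-trans
      (ℚ.⊓-glb {q ℚ.- δ} {q} {1ℚ}
        (≤-by-gap 0≤δ (solve 2 (λ q δ → δ := q :- (q :- δ)) refl q δ))
        (≤-by-gap (0≤gap q≤1+δ)
          (solve 2 (λ q δ → (con 1ℚ :+ δ) :- q := con 1ℚ :- (q :- δ)) refl q δ)))
      (ℚ.p≤q⊔p 0ℚ (q ℚ.⊓ 1ℚ))

  -- The real inequalities confine the terms only eventually, to [-δ, 1 + δ], where clamping moves
  -- them by at most δ; δ = ε/2 makes the final bound strict.
  clamp-null : ∀ x → 0ᵣ ≤ᵣ x → x ≤ᵣ 1ᵣ → Null (λ n → clamp (seq x n) ℚ.- seq x n)
  clamp-null x 0≤x x≤1 ε 0<ε with 0≤x _ (*-pos 0<½ 0<ε) | x≤1 _ (*-pos 0<½ 0<ε)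
  ... | M , lower | N , upper = M ℕ.⊔ N , λ n M⊔N≤n → ℚ.≤-<-trans
    (clamp-close (seq x n) (ℚ.<⇒≤ (*-pos 0<½ 0<ε))
      (lower n (ℕ.m⊔n≤o⇒m≤o M N M⊔N≤n)) (upper n (ℕ.m⊔n≤o⇒n≤o M N M⊔N≤n)))
    (½ε<ε 0<ε)

opaque
  ∑paths-cong : ∀ n {f g} → (∀ ss → f ss ≃ᵣ g ss) → ∑paths n f ≃ᵣ ∑paths n g
  ∑paths-cong zero    f≃g = f≃g []
  ∑paths-cong (suc n) f≃g = +ᵣ-cong (∑paths n _) (∑paths n _) (∑paths n _) (∑paths n _)
    (∑paths-cong n (λ ss → f≃g (up ∷ ss))) (∑paths-cong n (λ ss → f≃g (down ∷ ss)))

module _ (𝒶 𝒷 : Strategy) (𝒶≃𝒷 : ∀ i → Strategy.a 𝒶 i ≃ᵣ Strategy.a 𝒷 i) where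
  opaque
    1-cong : ∀ x y → x ≃ᵣ y → 1ᵣ -ᵣ x ≃ᵣ 1ᵣ -ᵣ y
    1-cong x y x≃y = +ᵣ-cong 1ᵣ 1ᵣ (-ᵣ x) (-ᵣ y) (≃ᵣ-refl 1ᵣ) (-ᵣ-cong x y x≃y)

    signed-cong : ∀ k → signed 𝒶 k ≃ᵣ signed 𝒷 k
    signed-cong (+ i)    = 𝒶≃𝒷 i
    signed-cong -[1+ i ] = 1-cong (Strategy.a 𝒶 (suc i)) (Strategy.a 𝒷 (suc i)) (𝒶≃𝒷 (suc i))

    stepProb-cong : ∀ k s → stepProb 𝒶 k s ≃ᵣ stepProb 𝒷 k s
    stepProb-cong k up   = signed-cong k
    stepProb-cong k down = 1-cong (signed 𝒶 k) (signed 𝒷 k) (signed-cong k)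

    pathProb-cong : ∀ {n} k (ss : Vec Step n) → pathProb 𝒶 k ss ≃ᵣ pathProb 𝒷 k ss
    pathProb-cong k []       = ≃ᵣ-refl 1ᵣ
    pathProb-cong k (s ∷ ss) = *ᵣ-cong (stepProb 𝒶 k s) (stepProb 𝒷 k s)
      (pathProb 𝒶 (move s k) ss) (pathProb 𝒷 (move s k) ss)
      (stepProb-cong k s) (pathProb-cong (move s k) ss)

    -- At a fixed horizon the expectation is a finite polynomial in the strategy's values; this
    -- carries the bound from `clamped` back to the given strategy.
    𝔼-cong : ∀ n F → 𝔼 𝒶 n F ≃ᵣ 𝔼 𝒷 n F
    𝔼-cong n F = ∑paths-cong n λ ss → ∑paths-cong n λ us →
      *ᵣ-cong (pathProb 𝒶 (+ 0) ss *ᵣ pathProb 𝒶 (+ 0) us)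
              (pathProb 𝒷 (+ 0) ss *ᵣ pathProb 𝒷 (+ 0) us)
              (F ss us) (F ss us)
        (*ᵣ-cong (pathProb 𝒶 (+ 0) ss) (pathProb 𝒷 (+ 0) ss)
                 (pathProb 𝒶 (+ 0) us) (pathProb 𝒷 (+ 0) us)
          (pathProb-cong (+ 0) ss) (pathProb-cong (+ 0) us))
        (≃ᵣ-refl (F ss us))

clampᵣ : ∀ x → 0ᵣ ≤ᵣ x → x ≤ᵣ 1ᵣ → ℝ
clampᵣ x 0≤x x≤1 = mkℝ (λ n → clamp (seq x n))
  (close⇒cauchy x {λ n → clamp (seq x n)} (clamp-null x 0≤x x≤1))

opaque
  pointwise-≤ᵣ : ∀ x y → (∀ n → seq x n ℚ.≤ seq y n) → x ≤ᵣ y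
  pointwise-≤ᵣ x y x≤y ε 0<ε = 0 , λ n _ → ℚ.≤-trans (x≤y n)
    (ℚ.≤-trans (p≤x+p (seq y n) (ℚ.<⇒≤ 0<ε)) (ℚ.≤-reflexive (ℚ.+-comm ε (seq y n))))

module _ (𝒶 : Strategy) where
  open Strategy 𝒶

  -- The value at 0 is replaced by the constant ½, since `b-neg` at 0 demands b = 1 - b at every
  -- index while `a₀≃½` holds only in the limit.
  clampedSeq : ℕ → ℝ
  clampedSeq zero    = ½ᵣ
  clampedSeq (suc i) = clampᵣ (a (suc i)) (0≤a (suc i)) (a≤1 (suc i))

  opaque
    0≤clampedSeq : ∀ i n → 0ℚ ℚ.≤ seq (clampedSeq i) n
    0≤clampedSeq zero    n = 0≤½
    0≤clampedSeq (suc i) n = 0≤clamp (seq (a (suc i)) n)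

    clampedSeq≤1 : ∀ i n → seq (clampedSeq i) n ℚ.≤ 1ℚ
    clampedSeq≤1 zero    n = ≤-by-gap 0≤½ refl
    clampedSeq≤1 (suc i) n = clamp≤1 (seq (a (suc i)) n)

  -- Replaces the approximating sequences by ones whose every term is an exact
  -- strategy over ℚ.
  clamped : Strategy
  clamped = record
    { a    = clampedSeq
    ; 0≤a  = λ i → pointwise-≤ᵣ 0ᵣ (clampedSeq i) (0≤clampedSeq i)
    ; a≤1  = λ i → pointwise-≤ᵣ (clampedSeq i) 1ᵣ (clampedSeq≤1 i)
    ; a₀≃½ = ≃ᵣ-refl ½ᵣ
    }

  opaque
    clampedSeq≃a : ∀ i → clampedSeq i ≃ᵣ a i
    clampedSeq≃a zero    = Null-cong
      (λ n → solve 2 (λ x y → :- (x :- y) := y :- x) refl (seq (a 0) n) ½) (Null-neg a₀≃½)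
    clampedSeq≃a (suc i) = clamp-null (a (suc i)) (0≤a (suc i)) (a≤1 (suc i))

    0≤b : ∀ m k → 0ℚ ℚ.≤ seq (signed clamped k) m
    0≤b m (+ i)    = 0≤clampedSeq i m
    0≤b m -[1+ i ] = 0≤gap (clampedSeq≤1 (suc i) m)

    b≤1 : ∀ m k → seq (signed clamped k) m ℚ.≤ 1ℚ
    b≤1 m (+ i)    = clampedSeq≤1 i m
    b≤1 m -[1+ i ] = ≤-by-gap (0≤clampedSeq (suc i) m)
      (solve 1 (λ x → x := con 1ℚ :- (con 1ℚ :- x)) refl (seq (clampedSeq (suc i)) m))

    b-neg : ∀ m k → seq (signed clamped (ℤ.- k)) m ≡ 1ℚ ℚ.- seq (signed clamped k) m
    b-neg m (+ zero)  = refl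
    b-neg m (+ suc i) = refl
    b-neg m -[1+ i ]  = sym (1-[1-x] (seq (clampedSeq (suc i)) m))

    -- Each agent survives with probability at least 1/4. The bound holds at every index `m` without
    -- error, hence passes to the limit.
    clamped-lower : ∀ e N m → natℚ N ≡ natℚ (suc e) ℚ.* natℚ (suc e) →
      natℚ N ℚ.* ((½ ℚ.* ½) ℚ.* (½ ℚ.* ½))
        ℚ.≤ seq (𝔼 clamped N (λ ss us → fromℕ (truncatedTime (suc e) ss us))) m
    clamped-lower e N m N≡d² = ℚ.≤-trans
      (ℚ.*-monoˡ-≤-nonNeg (natℚ N) {{ℚ.nonNegative (∑<-nonNeg N (λ _ → 0≤1))}} (begin
        (½ ℚ.* ½) ℚ.* (½ ℚ.* ½)  ≤⟨ ℚ.*-monoˡ-≤-nonNeg (½ ℚ.* ½) quarter≤x ⟩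
        (½ ℚ.* ½) ℚ.* x           ≤⟨ ℚ.*-monoʳ-≤-nonNeg x {{ℚ.nonNegative (survival-nonNeg _ N (+ 0))}} quarter≤x ⟩
        x ℚ.* x                   ∎))
      (Approximant.𝔼-lower clamped m (0≤b m) (b≤1 m) (b-neg m) (suc e) N)
      where
      open ℚ.≤-Reasoning
      open Chain (λ k → seq (signed clamped k) m) (0≤b m) (b≤1 m)

      x : ℚ
      x = survival (leftOf (suc e)) N (+ 0)

      quarter≤x : ½ ℚ.* ½ ℚ.≤ x
      quarter≤x = Symmetric.quarter≤q (b-neg m) e N N≡d²

-- The quadratic lower bound

1/64 : ℚ
1/64 = + 1 ℚ./ 64

opaque
  natℚ-square : ∀ d → natℚ (d ^ 2) ≡ natℚ d ℚ.* natℚ d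
  natℚ-square d = trans (natℚ-* d (d ℕ.* 1)) (cong (λ z → natℚ d ℚ.* natℚ z) (ℕ.*-identityʳ d))

  -- In units u = D/64, x is at least 4u and y differs from it by less than u, so y exceeds 3u. Of
  -- the 2u retained, one is the rational placed in the cut and the other the gap that `_<ᵣ_`
  -- requires.
  perturbed-lower : ∀ D x y → D ℚ.* ((½ ℚ.* ½) ℚ.* (½ ℚ.* ½)) ℚ.≤ x → 0ℚ ℚ.≤ D →
    ℚ.∣ x ℚ.- y ∣ ℚ.< 1/64 ℚ.* D →
    1/64 ℚ.* D ℚ.+ 1/64 ℚ.* D ℚ.≤ y
  perturbed-lower D x y h 0≤D k = ≤-by-gap
    (+-nonNeg (+-nonNeg (0≤gap h) (0≤gap (ℚ.≤-trans (x≤∣x∣ (x ℚ.- y)) (ℚ.<⇒≤ k))))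
      (*-nonNeg (ℚ.nonNegative⁻¹ 1/64) 0≤D))
    (solve 3 (λ D x y →
      (x :- D :* ((con ½ :* con ½) :* (con ½ :* con ½)))
        :+ (con 1/64 :* D :- (x :- y)) :+ con 1/64 :* D
      := y :- (con 1/64 :* D :+ con 1/64 :* D)) refl D x y)
    where
    x≤∣x∣ : ∀ x → x ℚ.≤ ℚ.∣ x ∣
    x≤∣x∣ x = subst₂ ℚ._≤_ (solve 1 (λ x → :- (:- x) := x) refl x) (ℚ.∣-p∣≡∣p∣ x) (-x≤∣x∣ (ℚ.- x))

opaque
  ≃ᵣ-lower : ∀ x y D → x ≃ᵣ y → (∀ n → D ℚ.* ((½ ℚ.* ½) ℚ.* (½ ℚ.* ½)) ℚ.≤ seq x n) → 0ℚ ℚ.≤ D →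
    0ℚ ℚ.< 1/64 ℚ.* D →
    ∃[ M ] (∀ n → M ℕ.≤ n → 1/64 ℚ.* D ℚ.+ 1/64 ℚ.* D ℚ.≤ seq y n)
  ≃ᵣ-lower x y D x≃y lower 0≤D 0<r with x≃y (1/64 ℚ.* D) 0<r
  ... | M , close = M , λ n M≤n →
    perturbed-lower D (seq x n) (seq y n) (lower n) 0≤D (close n M≤n)

opaque
  -- A supremum over truncations is bounded below by any one of them; the horizon d² is chosen, and
  -- `r` doubles as the gap.
  time-lower : ∀ e 𝒶 → let r = 1/64 ℚ.* (+ (suc e ^ 2) ℚ./ 1) in
    0ℚ ℚ.< r → r ∈ expectedTime (suc e) 𝒶
  time-lower e 𝒶 0<r = N , 1/64 ℚ.* (+ N ℚ./ 1) , 0<r ,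
    ≃ᵣ-lower (𝔼 (clamped 𝒶) N F) (𝔼 𝒶 N F) (+ N ℚ./ 1)
      (𝔼-cong (clamped 𝒶) 𝒶 (clampedSeq≃a 𝒶) N F)
      (λ n → subst (λ D → D ℚ.* ((½ ℚ.* ½) ℚ.* (½ ℚ.* ½)) ℚ.≤ seq (𝔼 (clamped 𝒶) N F) n)
        (natℚ≡/1 N) (clamped-lower 𝒶 e N n (natℚ-square (suc e))))
      (0≤/1 N) 0<r
    where
    N : ℕ
    N = suc e ^ 2

    F : Vec Step N → Vec Step N → ℝ
    F ss us = fromℕ (truncatedTime (suc e) ss us)

theorem2 : Σ[ c ∈ ℝ ] (0ᵣ <ᵣ c × ((d : ℕ) → 1 ≤ d → c *ᵣ fromℕ (d ^ 2) ≤ₗ R d))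
theorem2 = fromℚ 1/64 , (1/64 , 0<1/64 , 0 , λ _ _ → ℚ.≤-reflexive (ℚ.+-identityˡ _)) , below
  where
  0<1/64 : 0ℚ ℚ.< 1/64
  0<1/64 = ℚ.positive⁻¹ 1/64

  below : (d : ℕ) → 1 ≤ d → fromℚ 1/64 *ᵣ fromℕ (d ^ 2) ≤ₗ R d
  below (suc e) _ q (ε , 0<ε , M , q+ε≤r) =
    -- `inf` demands one rational above `q` for all strategies at once; d²/64 itself serves, as it
    -- does not depend on `𝒶`.
    1/64 ℚ.* (+ (suc e ^ 2) ℚ./ 1) , q<r , λ 𝒶 → time-lower e 𝒶 0<r
    where
    q<r : q ℚ.< 1/64 ℚ.* (+ (suc e ^ 2) ℚ./ 1)
    q<r = ℚ.<-≤-trans (subst (ℚ._< q ℚ.+ ε) (ℚ.+-identityʳ q) (ℚ.+-monoʳ-< q 0<ε))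
            (q+ε≤r M ℕ.≤-refl)

    0<r : 0ℚ ℚ.< 1/64 ℚ.* (+ (suc e ^ 2) ℚ./ 1)
    0<r = *-pos 0<1/64 (subst (0ℚ ℚ.<_)
      (trans (sym (natℚ-square (suc e))) (natℚ≡/1 (suc e ^ 2)))
      (*-pos (natℚ-pos e) (natℚ-pos e)))
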